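{- For every positive integer $k$, the $q,t$-Catalan number $C_{(k,k,k,k)}(q,t)$ is $q,t$-symmetric, i.e. $C_{(k,k,k,k)}(q,t)=C_{(k,k,k,k)}(t,q)$ as polynomials in $q,t$.
   Context: Let $k$ be a positive integer. A $(k,k,k,k)$-Dyck path (also called a $k^4$-Dyck path) is a lattice path starting and ending at level $0$ and never going below level $0$, with four red up steps of height $k$ and $4k$ blue down steps of height $1$, the first step being red. It is uniquely determined by parameters $(a,b,c)$: a red step, then $a$ blue steps, a red step, then $b$ blue steps, a red step, then $c$ blue steps, a red step, and then $4k-a-b-c$ blue steps. The set $\mathcal{D}_{k^4}$ of such paths is in bijection with the integer triples $(a,b,c)$ satisfying $$0\le a\le k,\qquad 0\le b\le 2k-a,\qquad 0\le c\le 3k-a-b.$$ For $D\in\mathcal{D}_{k^4}$ with parameters $(a,b,c)$, the statistics area and bounce are as follows: $$\mathrm{area}(D)=6k-3a-2b-c,$$ and $\mathrm{bounce}(D)$ is given by: 1. If $b\ge 2k-2a$: - $6a+3b+c-4k$, if $c\ge 4k-2a-2b$; - $5a+2b+\left\lceil\frac{c}{2}\right\rceil-2k$, if $c<4k-2a-2b$. 2. If $b<2k-2a$ and $b$ is even: - $4a+2b+c-2k$, if $c\ge 3k-a-\frac{3b}{2}$; - $2a+\frac{b}{2}+k+\left\lceil\frac{3a+\frac{3b}{2}+c-3k}{2}\right\rceil$, if $3k-3a-\frac{3b}{2}\le c<3k-a-\frac{3b}{2}$; - $3a+b+\left\lceil\frac{c}{3}\right\rceil$, if $c<3k-3a-\frac{3b}{2}$.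 3. If $b<2k-2a$ and $b$ is odd: - $4a+2b+c-2k+1$, if $c\ge 3k-a-\frac{3(b+1)}{2}+1$; - $2a+\frac{b+1}{2}+k+\left\lceil\frac{3a+\frac{3(b+1)}{2}+c-3k-1}{2}\right\rceil$, if $3k-3a-\frac{3(b+1)}{2}+1\le c<3k-a-\frac{3(b+1)}{2}+1$; - $3a+b+1+\left\lceil\frac{c-1}{3}\right\rceil$, if $c<3k-3a-\frac{3(b+1)}{2}+1$. The $q,t$-Catalan number is $$C_{(k,k,k,k)}(q,t)=\sum_{D\in\mathcal{D}_{k^4}}q^{\mathrm{area}(D)}t^{\mathrm{bounce}(D)}.$$ -}

module Defs where

open import Data.Bool.Base using (if_then_else_)
open import Data.Integer.Base as ℤ using (ℤ; 0ℤ; 1ℤ)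
open import Data.List.Base
  using (List; []; _∷_; _++_; map; concatMap; cartesianProductWith; replicate; upTo; head)
open import Data.List.Membership.Propositional using (_∈_; find; lose)
open import Data.List.Membership.Propositional.Properties
  using (∈-concatMap⁺; ∈-concatMap⁻; ∈-map⁺; ∈-map⁻; ∈-upTo⁺; ∈-upTo⁻)
open import Data.List.Properties using (∷-injectiveʳ)
open import Data.Maybe.Base using (just)
open import Data.Nat
  using (ℕ; zero; suc; _+_; _*_; _∸_; _/_; _≤_; _≟_; _≤?_; s≤s; s≤s⁻¹; ⌈_/2⌉)
open import Data.Nat.Divisibility using (_∣?_)
open import Data.Nat.Properties
open import Data.Nat.Solver using (module +-*-Solver)
open import Data.Product using (_×_; _,_; ∃-syntax)
open import Relation.Binary.PropositionalEquality
  using (_≡_; refl; sym; trans; cong; subst; module ≡-Reasoning)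
open import Relation.Nullary.Decidable using (does; _×-dec_)

-- The term (c , i , j) stands for c qⁱ tʲ, and a list of terms for their
-- sum.  Exponents may repeat, so the equality of ℤ[q,t] is _≈_, not _≡_.

Poly : Set
Poly = List (ℤ × ℕ × ℕ)

coeff : Poly → ℕ → ℕ → ℤ
coeff []                i j = 0ℤ
coeff ((c , m , n) ∷ p) i j =
  if does ((m ≟ i) ×-dec (n ≟ j)) then c ℤ.+ coeff p i j else coeff p i j

infix  4 _≈_
infixl 6 _⊕_
infixl 7 _⊗_
infixr 8 _↑_

_≈_ : Poly → Poly → Set
p ≈ r = ∀ i j → coeff p i j ≡ coeff r i j

q t 𝟙 : Poly
q = (1ℤ , 1 , 0) ∷ []
t = (1ℤ , 0 , 1) ∷ []
𝟙 = (1ℤ , 0 , 0) ∷ []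

_⊕_ : Poly → Poly → Poly
_⊕_ = _++_

_⊗_ : Poly → Poly → Poly
_⊗_ = cartesianProductWith
  λ { (c , m , n) (d , m′ , n′) → (c ℤ.* d , m + m′ , n + n′) }

_↑_ : Poly → ℕ → Poly
p ↑ zero  = 𝟙
p ↑ suc n = p ⊗ p ↑ n

∑ : {A : Set} → List A → (A → Poly) → Poly
∑ []       f = []
∑ (x ∷ xs) f = f x ⊕ ∑ xs f

data Step : Set where
  red blue : Step

#red #blue : List Step → ℕ
#red []          = 0
#red (red  ∷ w)  = suc (#red w)
#red (blue ∷ w)  = #red w
#blue []         = 0
#blue (red  ∷ w) = #blue w
#blue (blue ∷ w) = suc (#blue w)

-- Walk k h w: the path w, started at level h, never goes below level 0
-- and ends at level 0.

data Walk (k : ℕ) : ℕ → List Step → Set where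
  end  : Walk k 0 []
  up   : ∀ {h w} → Walk k (k + h) w → Walk k h (red ∷ w)
  down : ∀ {h w} → Walk k h w → Walk k (suc h) (blue ∷ w)

record IsDyck⁴ (k : ℕ) (w : List Step) : Set where
  constructor isDyck⁴
  field
    walk     : Walk k 0 w
    reds     : #red w ≡ 4
    blues    : #blue w ≡ 4 * k
    redFirst : head w ≡ just red

Params : Set
Params = ℕ × ℕ × ℕ

path : ℕ → Params → List Step
path k (a , b , c) =
  red ∷ replicate a blue ++
  red ∷ replicate b blue ++
  red ∷ replicate c blue ++
  red ∷ replicate (4 * k ∸ a ∸ b ∸ c) blue

𝒟ᵃᵇ : ℕ → ℕ → ℕ → List Params
𝒟ᵃᵇ k a b = map (λ c → (a , b , c)) (upTo (suc (3 * k ∸ a ∸ b)))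

𝒟ᵃ : ℕ → ℕ → List Params
𝒟ᵃ k a = concatMap (𝒟ᵃᵇ k a) (upTo (suc (2 * k ∸ a)))

-- All (a , b , c) with 0 ≤ a ≤ k, 0 ≤ b ≤ 2k - a and 0 ≤ c ≤ 3k - a - b,
-- each listed once.  See path-isDyck, dyck-isPath and path-injective below
-- for the bijection with the lattice paths.

𝒟 : ℕ → List Params
𝒟 k = concatMap (𝒟ᵃ k) (upTo (suc k))

-- Both statistics are nonnegative on 𝒟 k, and for parameters in 𝒟 k every
-- subtraction below has a nonnegative result, so that _∸_ is exact there;
-- the one exception is ⌈ (c - 1) / 3 ⌉ with c = 0, which is ⌈ -1/3 ⌉ = 0
-- and agrees with ⌈ (0 ∸ 1) /3⌉ = 0.  In the comparisons, subtracted terms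
-- have been moved to the other side.

area : ℕ → Params → ℕ
area k (a , b , c) = 6 * k ∸ 3 * a ∸ 2 * b ∸ c

⌈_/3⌉ : ℕ → ℕ
⌈ n /3⌉ = (n + 2) / 3

-- b ≥ 2k - 2a
bounce₁ : ℕ → Params → ℕ
bounce₁ k (a , b , c) =
  if does (4 * k ≤? 2 * a + 2 * b + c)
  then 6 * a + 3 * b + c ∸ 4 * k
  else 5 * a + 2 * b + ⌈ c /2⌉ ∸ 2 * k

-- b < 2k - 2a, b even; here e = b / 2
bounce₂ : ℕ → Params → ℕ
bounce₂ k (a , b , c) =
  let e = b / 2 in
  if does (3 * k ≤? a + 3 * e + c)
  then 4 * a + 2 * b + c ∸ 2 * k
  else if does (3 * k ≤? 3 * a + 3 * e + c)
  then 2 * a + e + k + ⌈ 3 * a + 3 * e + c ∸ 3 * k /2⌉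
  else 3 * a + b + ⌈ c /3⌉

-- b < 2k - 2a, b odd; here e = (b + 1) / 2
bounce₃ : ℕ → Params → ℕ
bounce₃ k (a , b , c) =
  let e = (b + 1) / 2 in
  if does (3 * k + 1 ≤? a + 3 * e + c)
  then 4 * a + 2 * b + c + 1 ∸ 2 * k
  else if does (3 * k + 1 ≤? 3 * a + 3 * e + c)
  then 2 * a + e + k + ⌈ 3 * a + 3 * e + c ∸ 3 * k ∸ 1 /2⌉
  else 3 * a + b + 1 + ⌈ c ∸ 1 /3⌉

bounce : ℕ → Params → ℕ
bounce k D@(a , b , c) =
  if does (2 * k ≤? 2 * a + b) then bounce₁ k D
  else if does (2 ∣? b)        then bounce₂ k D
  else                              bounce₃ k D

-- C k x y is C_{(k,k,k,k)}(x , y).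

C : ℕ → Poly → Poly → Poly
C k x y = ∑ (𝒟 k) λ D → x ↑ area k D ⊗ y ↑ bounce k D

∈𝒟⁺ : ∀ {k a b c} → a ≤ k → b ≤ 2 * k ∸ a → c ≤ 3 * k ∸ a ∸ b →
      (a , b , c) ∈ 𝒟 k
∈𝒟⁺ {k} {a} {b} a≤ b≤ c≤ =
  ∈-concatMap⁺ (𝒟ᵃ k) (lose (∈-upTo⁺ (s≤s a≤))
    (∈-concatMap⁺ (𝒟ᵃᵇ k a) (lose (∈-upTo⁺ (s≤s b≤))
      (∈-map⁺ (λ c → (a , b , c)) (∈-upTo⁺ (s≤s c≤))))))

∈𝒟⁻ : ∀ k {a b c} → (a , b , c) ∈ 𝒟 k →
      a ≤ k × b ≤ 2 * k ∸ a × c ≤ 3 * k ∸ a ∸ b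
∈𝒟⁻ k D∈ with find (∈-concatMap⁻ (𝒟ᵃ k) {xs = upTo (suc k)} D∈)
... | a′ , a∈ , D∈′
  with find (∈-concatMap⁻ (𝒟ᵃᵇ k a′) {xs = upTo (suc (2 * k ∸ a′))} D∈′)
... | b′ , b∈ , D∈″ with ∈-map⁻ (λ c → (a′ , b′ , c)) D∈″
... | _ , c∈ , refl =
  s≤s⁻¹ (∈-upTo⁻ a∈) , s≤s⁻¹ (∈-upTo⁻ b∈) , s≤s⁻¹ (∈-upTo⁻ c∈)

-- The inequalities in subtraction-free form: h₁, h₂, h₃ are the levels
-- just before the second, third and fourth red step.

private
  record Levels (k a b c : ℕ) : Set where
    constructor levels
    field
      {h₁ h₂ h₃} : ℕ
      e₁ : k ≡ a + h₁
      e₂ : k + h₁ ≡ b + h₂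
      e₃ : k + h₂ ≡ c + h₃

  cancel : ∀ {m} a {n} → m ≡ a + n → m ∸ a ≡ n
  cancel a {n} refl = m+n∸m≡n a n

  shift : ∀ k a h → k + (a + h) ≡ a + (k + h)
  shift = solve 3 (λ k a h → k :+ (a :+ h) := a :+ (k :+ h)) refl
    where open +-*-Solver

  module _ {k a h₁} (e₁ : k ≡ a + h₁) where
    open ≡-Reasoning

    2k≡ : 2 * k ≡ a + (k + h₁)
    2k≡ = begin
      k + (k + 0)   ≡⟨ cong (k +_) (+-identityʳ k) ⟩
      k + k         ≡⟨ cong (k +_) e₁ ⟩
      k + (a + h₁)  ≡⟨ shift k a h₁ ⟩
      a + (k + h₁)  ∎

    2k∸a : 2 * k ∸ a ≡ k + h₁
    2k∸a = cancel a 2k≡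

    module _ {b h₂} (e₂ : k + h₁ ≡ b + h₂) where

      3k≡ : 3 * k ≡ a + (b + (k + h₂))
      3k≡ = begin
        k + 2 * k           ≡⟨ cong (k +_) 2k≡ ⟩
        k + (a + (k + h₁))  ≡⟨ shift k a _ ⟩
        a + (k + (k + h₁))  ≡⟨ cong (λ x → a + (k + x)) e₂ ⟩
        a + (k + (b + h₂))  ≡⟨ cong (a +_) (shift k b h₂) ⟩
        a + (b + (k + h₂))  ∎

      3k∸a∸b : 3 * k ∸ a ∸ b ≡ k + h₂
      3k∸a∸b = cancel b (cancel a 3k≡)

      module _ {c h₃} (e₃ : k + h₂ ≡ c + h₃) where

        4k≡ : 4 * k ≡ a + (b + (c + (k + h₃)))
        4k≡ = begin
          k + 3 * k                 ≡⟨ cong (k +_) 3k≡ ⟩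
          k + (a + (b + (k + h₂)))  ≡⟨ shift k a _ ⟩
          a + (k + (b + (k + h₂)))  ≡⟨ cong (a +_) (shift k b _) ⟩
          a + (b + (k + (k + h₂)))  ≡⟨ cong (λ x → a + (b + (k + x))) e₃ ⟩
          a + (b + (k + (c + h₃)))  ≡⟨ cong (λ x → a + (b + x)) (shift k c h₃) ⟩
          a + (b + (c + (k + h₃)))  ∎

        4k∸a∸b∸c : 4 * k ∸ a ∸ b ∸ c ≡ k + h₃
        4k∸a∸b∸c = cancel c (cancel b (cancel a 4k≡))

  levels⇒∈𝒟 : ∀ {k a b c} → Levels k a b c → (a , b , c) ∈ 𝒟 k
  levels⇒∈𝒟 {k} {a} {b} {c} (levels {h₁} {h₂} {h₃} e₁ e₂ e₃) = ∈𝒟⁺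
    (subst (a ≤_) (sym e₁) (m≤m+n a h₁))
    (subst (b ≤_) (sym (trans (2k∸a e₁) e₂)) (m≤m+n b h₂))
    (subst (c ≤_) (sym (trans (3k∸a∸b e₁ e₂) e₃)) (m≤m+n c h₃))

  ∈𝒟⇒levels : ∀ k {a b c} → (a , b , c) ∈ 𝒟 k → Levels k a b c
  ∈𝒟⇒levels k {a} {b} {c} D∈ with ∈𝒟⁻ k D∈
  ... | a≤ , b≤ , c≤ = levels e₁ e₂ e₃
    where
    e₁ = sym (m+[n∸m]≡n a≤)
    e₂ = sym (m+[n∸m]≡n (subst (b ≤_) (2k∸a e₁) b≤))
    e₃ = sym (m+[n∸m]≡n (subst (c ≤_) (3k∸a∸b e₁ e₂) c≤))

  descend : ∀ {k w h} a → Walk k h w → Walk k (a + h) (replicate a blue ++ w)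
  descend zero    W = W
  descend (suc a) W = down (descend a W)

  finish : ∀ {k} h → Walk k h (replicate h blue)
  finish zero    = end
  finish (suc h) = down (finish h)

  #red-run : ∀ a w → #red (replicate a blue ++ w) ≡ #red w
  #red-run zero    w = refl
  #red-run (suc a) w = #red-run a w

  #red-replicate : ∀ a → #red (replicate a blue) ≡ 0
  #red-replicate zero    = refl
  #red-replicate (suc a) = #red-replicate a

  #blue-walk : ∀ {k h w} → Walk k h w → #blue w ≡ h + #red w * k
  #blue-walk end                      = refl
  #blue-walk (down W)                 = cong suc (#blue-walk W)
  #blue-walk {k} {h} (up {w = w} W) = begin
    #blue w               ≡⟨ #blue-walk W ⟩
    k + h + #red w * k    ≡⟨ +-assoc k h _ ⟩
    k + (h + #red w * k)  ≡⟨ shift k h _ ⟩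
    h + (k + #red w * k)  ∎
    where open ≡-Reasoning

  data FirstRun (k h n : ℕ) : List Step → Set where
    run : ∀ {h′ w} a → h ≡ a + h′ → Walk k (k + h′) w → #red w ≡ n →
          FirstRun k h n (replicate a blue ++ red ∷ w)

  firstRun : ∀ {k h w n} → Walk k h w → #red w ≡ suc n → FirstRun k h n w
  firstRun (up W)   eq = run 0 refl W (suc-injective eq)
  firstRun (down W) eq with firstRun W eq
  ... | run a h≡ W′ eq′ = run (suc a) (cong suc h≡) W′ eq′

  lastRun : ∀ {k h w} → Walk k h w → #red w ≡ 0 → w ≡ replicate h blue
  lastRun end      _  = refl
  lastRun (down W) eq = cong (blue ∷_) (lastRun W eq)

  run-injective : ∀ a a′ {w w′} →
                  replicate a blue ++ red ∷ w ≡ replicate a′ blue ++ red ∷ w′ →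
                  a ≡ a′ × w ≡ w′
  run-injective zero    zero     eq = refl , ∷-injectiveʳ eq
  run-injective (suc a) (suc a′) eq with run-injective a a′ (∷-injectiveʳ eq)
  ... | a≡ , w≡ = cong suc a≡ , w≡

path-isDyck : ∀ k {D} → D ∈ 𝒟 k → IsDyck⁴ k (path k D)
path-isDyck k {a , b , c} D∈ = isDyck⁴ W reds (trans (#blue-walk W) (cong (_* k) reds)) refl
  where
  open Levels (∈𝒟⇒levels k D∈)
  last : Walk k (k + h₃) (replicate (4 * k ∸ a ∸ b ∸ c) blue)
  last = subst (λ n → Walk k (k + h₃) (replicate n blue)) (sym (4k∸a∸b∸c e₁ e₂ e₃)) (finish (k + h₃))
  segment : ∀ {h h′ w} n → h ≡ n + h′ → Walk k (k + h′) w →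
            Walk k h (replicate n blue ++ red ∷ w)
  segment n refl V = descend n (up V)
  W : Walk k 0 (path k (a , b , c))
  W = up (segment a (trans (+-identityʳ k) e₁) (segment b e₂ (segment c e₃ last)))
  reds : #red (path k (a , b , c)) ≡ 4
  reds = cong suc (trans (#red-run a _) (cong suc (trans (#red-run b _)
           (cong suc (trans (#red-run c _) (cong suc (#red-replicate (4 * k ∸ a ∸ b ∸ c))))))))

dyck-isPath : ∀ k {w} → IsDyck⁴ k w → ∃[ D ] (D ∈ 𝒟 k × w ≡ path k D)
dyck-isPath k (isDyck⁴ (up W) reds _ _) with firstRun W (suc-injective reds)
... | run a e₁ W₁ r₁ with firstRun W₁ r₁
... | run b e₂ W₂ r₂ with firstRun W₂ r₂
... | run c e₃ W₃ r₃ = (a , b , c) , levels⇒∈𝒟 (levels e₁′ e₂ e₃) ,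
  cong (λ v → red ∷ replicate a blue ++ red ∷ replicate b blue ++
              red ∷ replicate c blue ++ red ∷ v)
    (trans (lastRun W₃ r₃)
           (cong (λ n → replicate n blue) (sym (4k∸a∸b∸c e₁′ e₂ e₃))))
  where e₁′ = trans (sym (+-identityʳ k)) e₁

path-injective : ∀ k {D D′} → path k D ≡ path k D′ → D ≡ D′
path-injective k {a , b , c} {a′ , b′ , c′} eq
  with run-injective a a′ (∷-injectiveʳ eq)
... | refl , eq₁ with run-injective b b′ eq₁
... | refl , eq₂ with run-injective c c′ eq₂
... | refl , _ = refl

-- The map (a , b , c) ↦ (a , b + 2 , c) from the paths for k to the paths
-- for k + 1 respects the case distinction in bounce and raises both area and
-- bounce by 2, so by induction it suffices to treat the unshifted paths, those
-- outside its image: a = k, or c = 3k - a - b, or b ≤ 1.  On them the pair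
-- (area , bounce) is injective, and its image consists of all (x , y) with
--   x + y ≤ 6k,  6k ≤ 3x + y,  6k ≤ x + 3y,  4k ≤ x + y,
-- where moreover x ≡ k mod 2 if x + y = 4k.  These conditions are invariant
-- under exchanging x and y.

module Submission where

open import Defs
open import Data.Bool.Base using (true; false; if_then_else_)
open import Data.Integer.Base as ℤ using (ℤ; 1ℤ)
import Data.Integer.Properties as ℤₚ
open import Data.List.Base using (List; []; _∷_; _++_; map; concatMap; filter; upTo)
open import Data.List.Properties using (map-∘; map-++; map-cong-local)
open import Data.List.Membership.Propositional using (_∈_; find)
open import Data.List.Membership.Propositional.Properties
  using (∈-concatMap⁻; ∈-map⁺; ∈-map⁻; ∈-++⁺ˡ; ∈-++⁺ʳ; ∈-++⁻; ∈-filter⁺; ∈-filter⁻)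
open import Data.List.Membership.Propositional.Properties.WithK using (unique∧set⇒bag)
open import Data.List.Relation.Binary.BagAndSetEquality using (∼bag⇒↭)
open import Data.List.Relation.Binary.Permutation.Propositional as ↭
    using (_↭_; ↭-trans; ↭-reflexive)
open import Data.List.Relation.Binary.Permutation.Propositional.Properties using (map⁺; ++⁺)
import Data.List.Relation.Unary.All as All
import Data.List.Relation.Unary.All.Properties as Allₚ
import Data.List.Relation.Unary.AllPairs as AllPairs
open import Data.List.Relation.Unary.Any using (here; there)
open import Data.List.Relation.Unary.Unique.Propositional using (Unique)
import Data.List.Relation.Unary.Unique.Propositional.Properties as Unique
open import Data.Nat
  using (ℕ; zero; suc; _+_; _*_; _∸_; _/_; _%_; _≤_; _<_; _≤?_; _<?_; _≟_; z≤n; s≤s; s≤s⁻¹; ⌈_/2⌉;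
      ⌊_/2⌋; NonZero)
open import Data.Nat.Divisibility
open import Data.Nat.DivMod
open import Data.Nat.Properties
open import Data.Nat.Tactic.RingSolver using (solve)
open import Data.Product using (_×_; _,_; ∃; ∃₂; ∃-syntax; proj₁; proj₂; map₁; swap)
open import Data.Sum using (inj₁; inj₂)
open import Function using (_∘_; _∋_; mk⇔)
open import Relation.Binary.PropositionalEquality hiding ([_])
open import Relation.Nullary
open import Relation.Nullary.Decidable using (does; _×-dec_; ¬?)

slack : ∀ {m n} d → n ≡ m + d → m ≤ n
slack {m} d refl = m≤m+n m d

-- Linear inequalities are derived by certificates: L ≤ R is a nonnegative
-- combination of the hypotheses, d is the remaining slack, and the resulting
-- identity is one of commutative semirings.  Likewise for linear-≡.

linear-≤ : ∀ {L R l r} d → L ≤ R → r + L ≡ l + R + d → l ≤ r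
linear-≤ {L} {R} {l} {r} d L≤R eq = +-cancelʳ-≤ L l r (begin
  l + L      ≤⟨ +-monoʳ-≤ l L≤R ⟩
  l + R      ≤⟨ m≤m+n (l + R) d ⟩
  l + R + d  ≡⟨ eq ⟨
  r + L      ∎)
  where open ≤-Reasoning

linear-≡ : ∀ {L R l r} → L ≡ R → l + R ≡ r + L → l ≡ r
linear-≡ {L} {l = l} {r} refl = +-cancelʳ-≡ L l r

scale-≤ : ∀ n {l r} → l ≤ r → n * l ≤ n * r
scale-≤ n = *-monoʳ-≤ n

add-≤ : ∀ {l r l′ r′} → l ≤ r → l′ ≤ r′ → l + l′ ≤ r + r′
add-≤ = +-mono-≤

-- The rounding step: n l ≤ n r + (n - 1) implies l ≤ r.

cancel-≤ : ∀ n .{{_ : NonZero n}} {l r} → n * l < n * suc r → l ≤ r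
cancel-≤ n {l} {r} = s≤s⁻¹ ∘ *-cancelˡ-< n l (suc r)

1≰0 : {A : Set} → 1 ≤ 0 → A
1≰0 ()

module _ {P : Set} {A : Set} {x y : A} where

  if-yes : (P? : Dec P) → P → (if does P? then x else y) ≡ x
  if-yes (yes _) _ = refl
  if-yes (no ¬p) p = contradiction p ¬p

  if-no : (P? : Dec P) → ¬ P → (if does P? then x else y) ≡ y
  if-no (yes p) ¬p = contradiction p ¬p
  if-no (no _)  _  = refl

-- Monomials and their coefficients

term : ℕ × ℕ → ℤ × ℕ × ℕ
term (i , j) = 1ℤ , i , j

q↑≡ : ∀ n → q ↑ n ≡ (1ℤ , n , 0) ∷ []
q↑≡ zero    = refl
q↑≡ (suc n) = cong (q ⊗_) (q↑≡ n)

t↑≡ : ∀ n → t ↑ n ≡ (1ℤ , 0 , n) ∷ []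
t↑≡ zero    = refl
t↑≡ (suc n) = cong (t ⊗_) (t↑≡ n)

∑-monomials : {A : Set} (xs : List A) (f : A → Poly) (g : A → ℕ × ℕ) →
              (∀ x → f x ≡ term (g x) ∷ []) → ∑ xs f ≡ map (term ∘ g) xs
∑-monomials []       f g eq = refl
∑-monomials (x ∷ xs) f g eq = cong₂ _++_ (eq x) (∑-monomials xs f g eq)

coeff-↭ : ∀ {p r} → p ↭ r → p ≈ r
coeff-↭ ↭.refl i j = refl
coeff-↭ (↭.prep (c , m , n) p↭r) i j =
  cong (λ z → if does ((m ≟ i) ×-dec (n ≟ j)) then c ℤ.+ z else z) (coeff-↭ p↭r i j)
coeff-↭ (↭.swap (c , m , n) (d , m′ , n′) p↭r) i j rewrite coeff-↭ p↭r i j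
  with does ((m ≟ i) ×-dec (n ≟ j)) | does ((m′ ≟ i) ×-dec (n′ ≟ j))
... | false | false = refl
... | false | true  = refl
... | true  | false = refl
... | true  | true  = ℤ-swap c d _
  where
  ℤ-swap : ∀ x y z → x ℤ.+ (y ℤ.+ z) ≡ y ℤ.+ (x ℤ.+ z)
  ℤ-swap x y z = trans (sym (ℤₚ.+-assoc x y z))
    (trans (cong (ℤ._+ z) (ℤₚ.+-comm x y)) (ℤₚ.+-assoc y x z))
coeff-↭ (↭.trans p↭r r↭s) i j = trans (coeff-↭ p↭r i j) (coeff-↭ r↭s i j)

weight : ℕ → Params → ℕ × ℕ
weight k D = area k D , bounce k D

C-qt : ∀ k → C k q t ≡ map (term ∘ weight k) (𝒟 k)
C-qt k = ∑-monomials (𝒟 k) _ _ λ D → monomial (area k D) (bounce k D)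
  where
  monomial : ∀ m n → q ↑ m ⊗ t ↑ n ≡ (1ℤ , m , n) ∷ []
  monomial m n rewrite q↑≡ m | t↑≡ n | +-identityʳ m = refl

C-tq : ∀ k → C k t q ≡ map (term ∘ swap ∘ weight k) (𝒟 k)
C-tq k = ∑-monomials (𝒟 k) _ _ λ D → monomial (area k D) (bounce k D)
  where
  monomial : ∀ m n → t ↑ m ⊗ q ↑ n ≡ (1ℤ , n , m) ∷ []
  monomial m n rewrite t↑≡ m | q↑≡ n | +-identityʳ m = refl

-- Remainders modulo two and three

halves : ∀ n → ∃₂ λ h e → e ≤ 1 × n ≡ 2 * h + e
halves n = n / 2 , n % 2 , s≤s⁻¹ (m%n<n n 2) ,
  trans (m≡m%n+[m/n]*n n 2) (trans (+-comm (n % 2) _) (cong (_+ n % 2) (*-comm (n / 2) 2)))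

thirds : ∀ n → ∃₂ λ h e → e ≤ 2 × n ≡ 3 * h + e
thirds n = n / 3 , n % 3 , s≤s⁻¹ (m%n<n n 3) ,
  trans (m≡m%n+[m/n]*n n 3) (trans (+-comm (n % 3) _) (cong (_+ n % 3) (*-comm (n / 3) 3)))

halves-unique : ∀ {r e r′ e′} → e ≤ 1 → e′ ≤ 1 → 2 * r + e ≡ 2 * r′ + e′ → r ≡ r′ × e ≡ e′
halves-unique {r} {e} {r′} {e′} p p′ eq = r≡r′ ,
    (linear-≡ (cong₂ _+_ eq (cong (2 *_) (sym r≡r′))) (solve (e ∷ e′ ∷ r ∷ r′ ∷ [])))
  where
  r≡r′ = ≤-antisym {r} {r′} (cancel-≤ 2
      (linear-≤ e (add-≤ (≤-reflexive eq) p′) (solve (e ∷ e′ ∷ r ∷ r′ ∷ []))))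
      (cancel-≤ 2 (linear-≤ e′ (add-≤ (≤-reflexive (sym eq)) p) (solve (e ∷ e′ ∷ r ∷ r′ ∷ []))))

thirds-unique : ∀ {r e r′ e′} → e ≤ 2 → e′ ≤ 2 → 3 * r + e ≡ 3 * r′ + e′ → r ≡ r′ × e ≡ e′
thirds-unique {r} {e} {r′} {e′} p p′ eq = r≡r′ ,
    (linear-≡ (cong₂ _+_ eq (cong (3 *_) (sym r≡r′))) (solve (e ∷ e′ ∷ r ∷ r′ ∷ [])))
  where
  r≡r′ = ≤-antisym {r} {r′} (cancel-≤ 3
      (linear-≤ e (add-≤ (≤-reflexive eq) p′) (solve (e ∷ e′ ∷ r ∷ r′ ∷ []))))
      (cancel-≤ 3 (linear-≤ e′ (add-≤ (≤-reflexive (sym eq)) p) (solve (e ∷ e′ ∷ r ∷ r′ ∷ []))))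

⌈/2⌉-unique : ∀ m w d → d ≤ 1 → m + d ≡ 2 * w → ⌈ m /2⌉ ≡ w
⌈/2⌉-unique m w zero z≤n eq = trans (cong ⌈_/2⌉ m≡w+w) (sym (n≡⌈n+n/2⌉ w))
  where
  m≡w+w : m ≡ w + w
  m≡w+w = linear-≡ eq (solve (m ∷ w ∷ []))
⌈/2⌉-unique m w (suc zero) (s≤s z≤n) eq = trans (cong ⌊_/2⌋ 1+m≡w+w) (sym (n≡⌊n+n/2⌋ w))
  where
  1+m≡w+w : suc m ≡ w + w
  1+m≡w+w = linear-≡ eq (solve (m ∷ w ∷ []))

/3-unique : ∀ n v j → j ≤ 2 → n ≡ v * 3 + j → n / 3 ≡ v
/3-unique _ v j j≤2 refl = trans (+-distrib-/-∣ˡ j (divides v refl))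
  (trans (cong₂ _+_ (m*n/n≡m v 3) (m<n⇒m/n≡0 (s≤s j≤2))) (+-identityʳ v))

⌈/3⌉-unique : ∀ c v d → d ≤ 2 → c + d ≡ 3 * v → ⌈ c /3⌉ ≡ v
⌈/3⌉-unique c v 0 p eq = /3-unique (c + 2) v 2 ≤-refl (linear-≡ eq (solve (c ∷ v ∷ [])))
⌈/3⌉-unique c v 1 p eq = /3-unique (c + 2) v 1 (s≤s z≤n) (linear-≡ eq (solve (c ∷ v ∷ [])))
⌈/3⌉-unique c v 2 p eq = /3-unique (c + 2) v 0 z≤n (linear-≡ eq (solve (c ∷ v ∷ [])))
⌈/3⌉-unique c v (suc (suc (suc d))) (s≤s (s≤s ())) eq

⌈∸1/3⌉-unique : ∀ c v d → d ≤ 2 → c + d ≡ 3 * v + 1 → ⌈ c ∸ 1 /3⌉ ≡ v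
⌈∸1/3⌉-unique zero zero     d d≤2 eq = refl
⌈∸1/3⌉-unique zero (suc v) d d≤2 eq = 1≰0
    (linear-≤ (3 * v + 1) (add-≤ (≤-reflexive (sym eq)) d≤2) (solve (d ∷ v ∷ [])))
⌈∸1/3⌉-unique (suc c) v      d d≤2 eq = ⌈/3⌉-unique c v d d≤2 (linear-≡ eq (solve (c ∷ d ∷ v ∷ [])))

2*n/2≡n : ∀ n → 2 * n / 2 ≡ n
2*n/2≡n n = trans (cong (_/ 2) (*-comm 2 n)) (m*n/n≡m n 2)

odd⇒2∤ : ∀ n m → n ≡ 2 * m + 1 → ¬ (2 ∣ n)
odd⇒2∤ n m n≡2m+1 (divides d n≡d*2) = 1≰0 (≤-reflexive (proj₂
  (halves-unique {m} {1} {d} {0} ≤-refl z≤n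
      (linear-≡ (cong₂ _+_ (sym n≡2m+1) n≡d*2) (solve (d ∷ m ∷ n ∷ []))))))

-- The bounce formula with the subtractions moved to the other side

area-≡ : ∀ k a b c {x} → 6 * k ≡ 3 * a + 2 * b + c + x → area k (a , b , c) ≡ x
area-≡ k a b c {x} eq rewrite eq
  | ∸-+-assoc (3 * a + 2 * b + c + x) (3 * a) (2 * b)
  | ∸-+-assoc (3 * a + 2 * b + c + x) (3 * a + 2 * b) c = m+n∸m≡n (3 * a + 2 * b + c) x

module _ (k a b c : ℕ) {y : ℕ} where

  module _ (2k≤2a+b : 2 * k ≤ 2 * a + b) where

    bounce-1a : 4 * k ≤ 2 * a + 2 * b + c → 6 * a + 3 * b + c ≡ 4 * k + y →
                bounce k (a , b , c) ≡ y
    bounce-1a p eq = trans (if-yes (2 * k ≤? 2 * a + b) 2k≤2a+b)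
      (trans (if-yes (4 * k ≤? 2 * a + 2 * b + c) p)
      (trans (cong (_∸ 4 * k) eq) (m+n∸m≡n (4 * k) y)))

    bounce-1b : 2 * a + 2 * b + c < 4 * k → 5 * a + 2 * b + ⌈ c /2⌉ ≡ 2 * k + y →
                bounce k (a , b , c) ≡ y
    bounce-1b p eq = trans (if-yes (2 * k ≤? 2 * a + b) 2k≤2a+b)
      (trans (if-no (4 * k ≤? 2 * a + 2 * b + c) (<⇒≱ p))
      (trans (cong (_∸ 2 * k) eq) (m+n∸m≡n (2 * k) y)))

  module _ (2a+b<2k : 2 * a + b < 2 * k) (e : ℕ) (b≡2e : b ≡ 2 * e) where

    private
      2∣b : 2 ∣ b
      2∣b = divides e (trans b≡2e (*-comm 2 e))

      b/2≡e : b / 2 ≡ e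
      b/2≡e = trans (cong (_/ 2) b≡2e) (2*n/2≡n e)

      bounce₂≡ : bounce k (a , b , c) ≡ bounce₂ k (a , b , c)
      bounce₂≡ = trans (if-no (2 * k ≤? 2 * a + b) (<⇒≱ 2a+b<2k)) (if-yes (2 ∣? b) 2∣b)

    bounce-2a : 3 * k ≤ a + 3 * e + c → 4 * a + 2 * b + c ≡ 2 * k + y →
                bounce k (a , b , c) ≡ y
    bounce-2a p eq rewrite bounce₂≡ | b/2≡e = trans (if-yes (3 * k ≤? a + 3 * e + c) p)
      (trans (cong (_∸ 2 * k) eq) (m+n∸m≡n (2 * k) y))

    bounce-2b : ∀ {m} → a + 3 * e + c < 3 * k → 3 * a + 3 * e + c ≡ 3 * k + m →
                2 * a + e + k + ⌈ m /2⌉ ≡ y → bounce k (a , b , c) ≡ y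
    bounce-2b {m} p eq eq′ rewrite bounce₂≡ | b/2≡e =
      trans (if-no (3 * k ≤? a + 3 * e + c) (<⇒≱ p))
      (trans (if-yes (3 * k ≤? 3 * a + 3 * e + c) (slack m eq))
      (trans (cong (λ n → 2 * a + e + k + ⌈ n /2⌉) (trans (cong (_∸ 3 * k) eq) (m+n∸m≡n (3 * k) m)))
          eq′))

    bounce-2c : 3 * a + 3 * e + c < 3 * k → 3 * a + b + ⌈ c /3⌉ ≡ y → bounce k (a , b , c) ≡ y
    bounce-2c p eq rewrite bounce₂≡ | b/2≡e =
      trans (if-no (3 * k ≤? a + 3 * e + c) (<⇒≱ p′))
      (trans (if-no (3 * k ≤? 3 * a + 3 * e + c) (<⇒≱ p)) eq)
      where
      p′ : a + 3 * e + c < 3 * k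
      p′ = linear-≤ (2 * a) p (solve (a ∷ c ∷ e ∷ k ∷ []))

  module _ (2a+b<2k : 2 * a + b < 2 * k) (e : ℕ) (b+1≡2e : b + 1 ≡ 2 * e) where

    private
      2∤b : ¬ (2 ∣ b)
      2∤b 2∣b = contradiction (∣1⇒≡1 (∣m+n∣m⇒∣n (divides e (trans b+1≡2e (*-comm 2 e))) 2∣b)) λ ()

      b+1/2≡e : (b + 1) / 2 ≡ e
      b+1/2≡e = trans (cong (_/ 2) b+1≡2e) (2*n/2≡n e)

      bounce₃≡ : bounce k (a , b , c) ≡ bounce₃ k (a , b , c)
      bounce₃≡ = trans (if-no (2 * k ≤? 2 * a + b) (<⇒≱ 2a+b<2k)) (if-no (2 ∣? b) 2∤b)

    bounce-3a : 3 * k + 1 ≤ a + 3 * e + c → 4 * a + 2 * b + c + 1 ≡ 2 * k + y →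
                bounce k (a , b , c) ≡ y
    bounce-3a p eq rewrite bounce₃≡ | b+1/2≡e = trans (if-yes (3 * k + 1 ≤? a + 3 * e + c) p)
      (trans (cong (_∸ 2 * k) eq) (m+n∸m≡n (2 * k) y))

    bounce-3b : ∀ {m} → a + 3 * e + c < 3 * k + 1 → 3 * a + 3 * e + c ≡ 3 * k + (1 + m) →
                2 * a + e + k + ⌈ m /2⌉ ≡ y → bounce k (a , b , c) ≡ y
    bounce-3b {m} p eq eq′ rewrite bounce₃≡ | b+1/2≡e =
      trans (if-no (3 * k + 1 ≤? a + 3 * e + c) (<⇒≱ p))
      (trans (if-yes (3 * k + 1 ≤? 3 * a + 3 * e + c)
          (linear-≤ m (≤-reflexive (sym eq)) (solve (a ∷ c ∷ e ∷ k ∷ m ∷ []))))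
      (trans (cong (λ n → 2 * a + e + k + ⌈ n ∸ 1 /2⌉)
          (trans (cong (_∸ 3 * k) eq) (m+n∸m≡n (3 * k) (1 + m)))) eq′))

    bounce-3c : 3 * a + 3 * e + c < 3 * k + 1 → 3 * a + b + 1 + ⌈ c ∸ 1 /3⌉ ≡ y →
                bounce k (a , b , c) ≡ y
    bounce-3c p eq rewrite bounce₃≡ | b+1/2≡e =
      trans (if-no (3 * k + 1 ≤? a + 3 * e + c) (<⇒≱ p′))
      (trans (if-no (3 * k + 1 ≤? 3 * a + 3 * e + c) (<⇒≱ p)) eq)
      where
      p′ : a + 3 * e + c < 3 * k + 1
      p′ = linear-≤ (2 * a) p (solve (a ∷ c ∷ e ∷ k ∷ []))

-- Pieces of the set of unshifted paths

data Zone : Set where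
  z₁ z₂ z₃ z₄ z₅ z₆ : Zone

-- In Piece z k a b c x y, the path (a , b , c) has area x and bounce y.  The
-- pieces 1 and 3 have a = k, 2 and 4 have c = 3k - a - b, 5 and 6 have b ≤ 1.
-- The constructors are parametrised by slack variables, so that the
-- inequalities between k, a, b and c hold because all of these are natural
-- numbers; e, ē and δ are bits, and w = ⌈ m / 2 ⌉.

data Piece : Zone → (k a b c x y : ℕ) → Set where
  piece₁ : ∀ m s h → let k = m + s + h in
           Piece z₁ k k (m + s) (m + 2 * h) (s + h) (4 * k + 2 * m + s)
  piece₂ : ∀ n s u → let k = n + s + u + 1 in
           Piece z₂ k (n + s) (2 * u + 2 + n) (n + 2 * s + u + 1) (s + u + 1) (3 * k + 3 * n + s)
  piece₃ : ∀ b s r e → e ≤ 1 → 1 ≤ 2 * r + e → let k = b + s + r + e in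
           Piece z₃ k k b (2 * s + e) (k + 2 * r + e) (3 * k + 2 * b + s + e)
  piece₄ : ∀ a d r e → e ≤ 1 → 1 ≤ 2 * r + e → let k = a + d + r + e in
           Piece z₄ k a (2 * d + e) (2 * a + d + 3 * r + 2 * e) (k + 2 * r + e)
               (k + 3 * a + 2 * d + 2 * e)
  piece₅ : ∀ a A e ē m s w δ → e + ē ≡ 1 → δ ≤ 1 → 2 * a + e ≡ m + s + 1 → m + δ ≡ 2 * w →
           let k = a + A + 1 in
           Piece z₅ k a e (3 * A + 1 + 2 * ē + m) (3 * A + 3 + a + s + ē) (k + 2 * a + e + w)
  piece₆ : ∀ a r v e c ρ → e ≤ 1 → ρ ≤ 2 → 1 ≤ 3 * r + ρ → c + 2 * e + ρ ≡ 3 * v →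
           let k = a + r + v in
           Piece z₆ k a e c (3 * k + 3 * r + ρ) (3 * a + v + e)

-- The target indices are explicit because solve does not see through
-- metavariables in the equations.

cast : ∀ {z k a b c x y} k′ a′ b′ c′ x′ y′ → Piece z k a b c x y →
       k ≡ k′ → a ≡ a′ → b ≡ b′ → c ≡ c′ → x ≡ x′ → y ≡ y′ → Piece z k′ a′ b′ c′ x′ y′
cast _ _ _ _ _ _ p refl refl refl refl refl refl = p

piece-area : ∀ {z k a b c x y} → Piece z k a b c x y → area k (a , b , c) ≡ x
piece-area {k = k} {a} {b} {c} (piece₁ m s h) = area-≡ k a b c (solve (h ∷ m ∷ s ∷ []))
piece-area {k = k} {a} {b} {c} (piece₂ n s u) = area-≡ k a b c (solve (n ∷ s ∷ u ∷ []))
piece-area {k = k} {a} {b} {c} (piece₃ _ s r e e≤1 g≥1) = area-≡ k a b c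
    (solve (b ∷ e ∷ r ∷ s ∷ []))
piece-area {k = k} {a} {b} {c} (piece₄ _ d r e e≤1 g≥1) = area-≡ k a b c
    (solve (a ∷ d ∷ e ∷ r ∷ []))
piece-area {k = k} {a} {b} {c} (piece₅ _ A e ē m s w δ eē δ≤1 p mw) = area-≡ k a b c
    (linear-≡ (cong₂ _+_ (cong (3 *_) (sym eē)) p) (solve (A ∷ a ∷ e ∷ m ∷ s ∷ ē ∷ [])))
piece-area {k = k} {a} {b} {c} (piece₆ _ r v e _ ρ e≤1 ρ≤2 f≥1 cv) = area-≡ k a b c
    (linear-≡ (sym cv) (solve (a ∷ c ∷ e ∷ r ∷ v ∷ ρ ∷ [])))

piece-bounce : ∀ {z k a b c x y} → Piece z k a b c x y → bounce k (a , b , c) ≡ y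
piece-bounce {k = k} {a} {b} {c} (piece₁ m s h) =
  bounce-1a k a b c (slack (m + s) (solve (h ∷ m ∷ s ∷ []))) (slack m (solve (h ∷ m ∷ s ∷ [])))
      (solve (h ∷ m ∷ s ∷ []))
piece-bounce {k = k} {a} {b} {c} (piece₂ n s u) =
  bounce-1a k a b c (slack n (solve (n ∷ s ∷ u ∷ []))) (slack (n + u + 1) (solve (n ∷ s ∷ u ∷ [])))
      (solve (n ∷ s ∷ u ∷ []))
piece-bounce {k = k} {a} {b} {c} {y = y} (piece₃ _ s r e e≤1 g≥1) =
  bounce-1b k a b c (slack b (solve (b ∷ e ∷ r ∷ s ∷ [])))
      (linear-≤ 0 g≥1 (solve (b ∷ e ∷ r ∷ s ∷ [])))
    (trans (cong (5 * a + 2 * b +_) (⌈/2⌉-unique (2 * s + e) (s + e) e e≤1 (solve (e ∷ s ∷ []))))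
        5a+2b+s+e≡2k+y)
  where
  5a+2b+s+e≡2k+y : 5 * a + 2 * b + (s + e) ≡ 2 * k + y
  5a+2b+s+e≡2k+y = solve (b ∷ e ∷ r ∷ s ∷ [])
piece-bounce {k = k} {a} {b} {c} (piece₄ _ d r zero e≤1 g≥1) =
  bounce-2a k a b c (linear-≤ 0 g≥1 (solve (a ∷ d ∷ r ∷ []))) d (solve (d ∷ []))
      (slack d (solve (a ∷ d ∷ r ∷ []))) (solve (a ∷ d ∷ r ∷ []))
piece-bounce {k = k} {a} {b} {c} (piece₄ _ d r (suc zero) e≤1 g≥1) =
  bounce-3a k a b c (slack (2 * r) (solve (a ∷ d ∷ r ∷ []))) (d + 1) (solve (d ∷ []))
      (slack (d + 1) (solve (a ∷ d ∷ r ∷ []))) (solve (a ∷ d ∷ r ∷ []))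
piece-bounce (piece₄ _ d r (suc (suc e)) (s≤s ()) g≥1)
piece-bounce {k = k} {a} {b} {c} {y = y} (piece₅ _ A zero _ m s w δ refl δ≤1 p mw) =
  bounce-2b k a b c (slack (2 * A + 1) (solve (A ∷ a ∷ []))) 0 refl {m}
      (linear-≤ s (≤-reflexive (sym p)) (solve (A ∷ a ∷ m ∷ s ∷ []))) (solve (A ∷ a ∷ m ∷ []))
    (trans (cong (2 * a + 0 + k +_) (⌈/2⌉-unique m w δ δ≤1 mw)) 2a+k+w≡y)
  where
  2a+k+w≡y : 2 * a + 0 + k + w ≡ y
  2a+k+w≡y = solve (A ∷ a ∷ w ∷ [])
piece-bounce {k = k} {a} {b} {c} {y = y} (piece₅ _ A (suc zero) zero m zero w δ refl δ≤1 p mw) =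
  bounce-3a k a b c (slack (2 * A) (solve (A ∷ a ∷ []))) 1 refl
      (linear-≤ 0 (≤-reflexive p) (solve (A ∷ a ∷ m ∷ [])))
      (linear-≡ (cong₂ _+_ (sym p) (sym w≡a)) (solve (A ∷ a ∷ m ∷ w ∷ [])))
  where
  w≡a = trans (sym (⌈/2⌉-unique m w δ δ≤1 mw))
      (⌈/2⌉-unique m a 0 z≤n (linear-≡ (sym p) (solve (a ∷ m ∷ []))))
piece-bounce {k = k} {a} {b} {c} {y = y} (piece₅ _ A (suc zero) zero m (suc s) w δ refl δ≤1 p mw) =
  bounce-3b k a b c (slack (2 * A) (solve (A ∷ a ∷ []))) 1 refl {m}
      (linear-≤ s (≤-reflexive (sym p)) (solve (A ∷ a ∷ m ∷ s ∷ []))) (solve (A ∷ a ∷ m ∷ []))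
    (trans (cong (2 * a + 1 + k +_) (⌈/2⌉-unique m w δ δ≤1 mw)) 2a+1+k+w≡y)
  where
  2a+1+k+w≡y : 2 * a + 1 + k + w ≡ y
  2a+1+k+w≡y = solve (A ∷ a ∷ w ∷ [])
piece-bounce (piece₅ _ A (suc (suc e)) _ m s w δ () δ≤1 p mw)
piece-bounce {k = k} {a} {b} {c} {y = y} (piece₆ _ r v zero _ ρ e≤1 ρ≤2 f≥1 cv) =
  bounce-2c k a b c (cancel-≤ 2
      (linear-≤ (c + r + v) (add-≤ (≤-reflexive cv) f≥1) (solve (a ∷ c ∷ r ∷ v ∷ ρ ∷ [])))) 0 refl
      (linear-≤ 0 (add-≤ (≤-reflexive cv) f≥1) (solve (a ∷ c ∷ r ∷ v ∷ ρ ∷ [])))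
    (trans (cong (3 * a + 0 +_) (⌈/3⌉-unique c v ρ ρ≤2 (linear-≡ cv (solve (c ∷ v ∷ ρ ∷ [])))))
        3a+v≡y)
  where
  3a+v≡y : 3 * a + 0 + v ≡ y
  3a+v≡y = solve (a ∷ v ∷ [])
piece-bounce {k = k} {a} {b} {c} {y = y} (piece₆ _ r zero (suc zero) _ ρ e≤1 ρ≤2 f≥1 cv) = 1≰0
    (linear-≤ (c + ρ + 1) (≤-reflexive cv) (solve (c ∷ ρ ∷ [])))
piece-bounce {k = k} {a} {b} {c} {y = y} (piece₆ _ r (suc v′) (suc zero) _ ρ e≤1 ρ≤2 f≥1 cv) =
  bounce-3c k a b c (slack (2 * r + 2 * v′) (solve (a ∷ r ∷ v′ ∷ []))) 1 refl
      (linear-≤ 0 (add-≤ (≤-reflexive cv) f≥1) (solve (a ∷ c ∷ r ∷ v′ ∷ ρ ∷ [])))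
    (trans (cong (3 * a + 1 + 1 +_)
        (⌈∸1/3⌉-unique c v′ ρ ρ≤2 (linear-≡ cv (solve (c ∷ v′ ∷ ρ ∷ []))))) 3a+2+v′≡y)
  where
  3a+2+v′≡y : 3 * a + 1 + 1 + v′ ≡ y
  3a+2+v′≡y = solve (a ∷ v′ ∷ [])
piece-bounce (piece₆ _ r v (suc (suc e)) _ ρ (s≤s ()) ρ≤2 f≥1 cv)

piece-weight : ∀ {z k a b c x y} → Piece z k a b c x y → weight k (a , b , c) ≡ (x , y)
piece-weight p = cong₂ _,_ (piece-area p) (piece-bounce p)

record Bounded (k a b c : ℕ) : Set where
  constructor bounded
  field
    a≤ : a ≤ k
    b≤ : a + b ≤ 2 * k
    c≤ : a + b + c ≤ 3 * k

Shifted : ℕ → Params → Set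
Shifted k (a , b , c) = 2 ≤ b × a < k × a + b + c < 3 * k

piece-bounded : ∀ {z k a b c x y} → Piece z k a b c x y → Bounded k a b c
piece-bounded (piece₁ m s h) = bounded (slack 0 (solve (h ∷ m ∷ s ∷ [])))
    (slack h (solve (h ∷ m ∷ s ∷ []))) (slack s (solve (h ∷ m ∷ s ∷ [])))
piece-bounded (piece₂ n s u) = bounded (slack (u + 1) (solve (n ∷ s ∷ u ∷ [])))
    (slack s (solve (n ∷ s ∷ u ∷ []))) (slack 0 (solve (n ∷ s ∷ u ∷ [])))
piece-bounded (piece₃ b s r e e≤1 g≥1) = bounded (slack 0 (solve (b ∷ e ∷ r ∷ s ∷ [])))
    (slack (e + r + s) (solve (b ∷ e ∷ r ∷ s ∷ [])))
    (slack (b + e + 2 * r) (solve (b ∷ e ∷ r ∷ s ∷ [])))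
piece-bounded (piece₄ a d r e e≤1 g≥1) = bounded (slack (d + e + r) (solve (a ∷ d ∷ e ∷ r ∷ [])))
    (slack (a + e + 2 * r) (solve (a ∷ d ∷ e ∷ r ∷ []))) (slack 0 (solve (a ∷ d ∷ e ∷ r ∷ [])))
piece-bounded (piece₅ a A e ē m s w δ eē δ≤1 p mw) =
  bounded (slack (A + 1) (solve (A ∷ a ∷ [])))
      (linear-≤ (2 * A + a + ē + 1) (≤-reflexive eē) (solve (A ∷ a ∷ e ∷ ē ∷ [])))
      (linear-≤ (s + 1) (add-≤ (scale-≤ 2 (≤-reflexive eē)) (≤-reflexive (sym p)))
      (solve (A ∷ a ∷ e ∷ m ∷ s ∷ ē ∷ [])))
piece-bounded (piece₆ a r v e c ρ e≤1 ρ≤2 f≥1 cv) =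
  bounded (slack (r + v) (solve (a ∷ r ∷ v ∷ [])))
      (*-cancelˡ-≤ 2 (linear-≤ (2 * a + c + 4 * r + v + ρ) (≤-reflexive cv)
      (solve (a ∷ c ∷ e ∷ r ∷ v ∷ ρ ∷ []))))
      (linear-≤ (2 * a + e + 3 * r + ρ) (≤-reflexive cv) (solve (a ∷ c ∷ e ∷ r ∷ v ∷ ρ ∷ [])))

piece-unshifted : ∀ {z k a b c x y} → Piece z k a b c x y → ¬ Shifted k (a , b , c)
piece-unshifted (piece₁ m s h) (_ , a<k , _) = <-irrefl refl a<k
piece-unshifted (piece₂ n s u) (_ , _ , lt) = 1≰0 (linear-≤ 0 lt (solve (n ∷ s ∷ u ∷ [])))
piece-unshifted (piece₃ b s r e e≤1 g≥1) (_ , a<k , _) = <-irrefl refl a<k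
piece-unshifted (piece₄ a d r e e≤1 g≥1) (_ , _ , lt) = 1≰0
    (linear-≤ 0 lt (solve (a ∷ d ∷ e ∷ r ∷ [])))
piece-unshifted (piece₅ a A e ē m s w δ eē δ≤1 p mw) (2≤e , _) = 1≰0
    (linear-≤ ē (add-≤ 2≤e (≤-reflexive eē)) (solve (e ∷ ē ∷ [])))
piece-unshifted (piece₆ a r v e c ρ e≤1 ρ≤2 f≥1 cv) (2≤e , _) = 1≰0
    (linear-≤ 0 (add-≤ 2≤e e≤1) (solve (e ∷ [])))

record Region (k x y : ℕ) : Set where
  constructor region
  field
    x+y≤  : x + y ≤ 6 * k
    ≤3x+y : 6 * k ≤ 3 * x + y
    ≤x+3y : 6 * k ≤ x + 3 * y
    ≤x+y  : 4 * k ≤ x + y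
    even  : x + y ≡ 4 * k → 2 ∣ x + k

Region-sym : ∀ {k x y} → Region k x y → Region k y x
Region-sym {k} {x} {y} (region x+y≤ ≤3x+y ≤x+3y ≤x+y even) = region
  (linear-≤ 0 x+y≤ (solve (k ∷ x ∷ y ∷ []))) (linear-≤ 0 ≤x+3y (solve (k ∷ x ∷ y ∷ [])))
      (linear-≤ 0 ≤3x+y (solve (k ∷ x ∷ y ∷ [])))
  (linear-≤ 0 ≤x+y (solve (k ∷ x ∷ y ∷ [])))
  λ eq → ∣m+n∣m⇒∣n (divides (3 * k) (sum eq)) (even (trans (+-comm x y) eq))
  where
  sum : y + x ≡ 4 * k → x + k + (y + k) ≡ 3 * k * 2
  sum eq = linear-≡ eq (solve (k ∷ x ∷ y ∷ []))

piece-region : ∀ {z k a b c x y} → Piece z k a b c x y → Region k x y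
piece-region {k = k} {x = x} {y = y} (piece₁ m s h) =
  region (slack h (solve (h ∷ m ∷ s ∷ []))) (slack (h + 2 * s) (solve (h ∷ m ∷ s ∷ [])))
      (slack (7 * h + 12 * m + 10 * s) (solve (h ∷ m ∷ s ∷ [])))
      (slack (h + 2 * m + 2 * s) (solve (h ∷ m ∷ s ∷ []))) λ eq → divides (s + h) (x+k eq)
  where
  x+k : x + y ≡ 4 * k → x + k ≡ (s + h) * 2
  x+k eq = ≤-antisym (linear-≤ (h + m + 2 * s) (≤-reflexive eq) (solve (h ∷ m ∷ s ∷ [])))
      (slack m (solve (h ∷ m ∷ s ∷ [])))
piece-region {k = k} {x = x} {y = y} (piece₂ n s u) =
  region (slack (s + 2 * u + 2) (solve (n ∷ s ∷ u ∷ []))) (slack s (solve (n ∷ s ∷ u ∷ [])))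
      (slack (12 * n + 7 * s + 4 * u + 4) (solve (n ∷ s ∷ u ∷ [])))
      (slack (2 * n + s) (solve (n ∷ s ∷ u ∷ []))) λ eq → divides (s + u + 1) (x+k eq)
  where
  x+k : x + y ≡ 4 * k → x + k ≡ (s + u + 1) * 2
  x+k eq = ≤-antisym (linear-≤ (n + s) (≤-reflexive eq) (solve (n ∷ s ∷ u ∷ [])))
      (slack n (solve (n ∷ s ∷ u ∷ [])))
piece-region {k = k} {x = x} {y = y} (piece₃ b s r e e≤1 g≥1) =
  region (slack s (solve (b ∷ e ∷ r ∷ s ∷ [])))
      (slack (2 * b + 4 * e + 6 * r + s) (solve (b ∷ e ∷ r ∷ s ∷ [])))
      (slack (10 * b + 8 * e + 6 * r + 7 * s) (solve (b ∷ e ∷ r ∷ s ∷ [])))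
      (slack (2 * b + 2 * e + 2 * r + s) (solve (b ∷ e ∷ r ∷ s ∷ [])))
  λ eq → 1≰0 (linear-≤ (2 * b + e + s) (add-≤ (≤-reflexive eq) g≥1) (solve (b ∷ e ∷ r ∷ s ∷ [])))
piece-region {k = k} {x = x} {y = y} (piece₄ a d r e e≤1 g≥1) =
  region (slack (a + 2 * d + e + 2 * r) (solve (a ∷ d ∷ e ∷ r ∷ [])))
      (slack (a + 3 * e + 4 * r) (solve (a ∷ d ∷ e ∷ r ∷ [])))
      (slack (7 * a + 4 * d + 5 * e) (solve (a ∷ d ∷ e ∷ r ∷ [])))
      (slack (a + e) (solve (a ∷ d ∷ e ∷ r ∷ []))) λ eq → divides (k + r) (x+k eq)
  where
  x+k : x + y ≡ 4 * k → x + k ≡ (k + r) * 2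
  x+k eq = ≤-antisym (linear-≤ a (≤-reflexive eq) (solve (a ∷ d ∷ e ∷ r ∷ [])))
      (slack e (solve (a ∷ d ∷ e ∷ r ∷ [])))
piece-region {k = k} {x = x} {y = y} (piece₅ a A e ē m s w δ eē δ≤1 p mw) = region
  (linear-≤ (2 * A + w + ē) (add-≤
      (add-≤ (add-≤ (scale-≤ 2 (≤-reflexive eē)) (≤-reflexive (sym p))) (≤-reflexive (sym mw))) δ≤1)
      (solve (A ∷ a ∷ e ∷ m ∷ s ∷ w ∷ ē ∷ δ ∷ [])))
  (slack (4 * A + e + 3 * s + w + 3 * ē + 4) (solve (A ∷ a ∷ e ∷ s ∷ w ∷ ē ∷ [])))
  (slack (4 * a + 3 * e + s + 3 * w + ē) (solve (A ∷ a ∷ e ∷ s ∷ w ∷ ē ∷ [])))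
  (slack (e + s + w + ē) (solve (A ∷ a ∷ e ∷ s ∷ w ∷ ē ∷ [])))
  λ eq → 1≰0 (linear-≤ (s + w) (add-≤ (≤-reflexive eq) (≤-reflexive (sym eē)))
      (solve (A ∷ a ∷ e ∷ s ∷ w ∷ ē ∷ [])))
piece-region {k = k} {x = x} {y = y} (piece₆ a r v e c ρ e≤1 ρ≤2 f≥1 cv) = region
  (cancel-≤ 3 (linear-≤ (2 * c + e) (add-≤ ρ≤2 (scale-≤ 2 (≤-reflexive cv)))
      (solve (a ∷ c ∷ e ∷ r ∷ v ∷ ρ ∷ []))))
  (slack (6 * a + e + 12 * r + 4 * v + 3 * ρ) (solve (a ∷ e ∷ r ∷ v ∷ ρ ∷ [])))
  (slack (6 * a + 3 * e + ρ) (solve (a ∷ e ∷ r ∷ v ∷ ρ ∷ [])))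
  (slack (2 * a + e + 2 * r + ρ) (solve (a ∷ e ∷ r ∷ v ∷ ρ ∷ [])))
  λ eq → 1≰0 (linear-≤ (4 * a + 2 * e + r + ρ) (add-≤ (scale-≤ 2 (≤-reflexive eq)) f≥1)
      (solve (a ∷ e ∷ r ∷ v ∷ ρ ∷ [])))

-- The weight of a path alone tells which piece the path belongs to.

zone : (k x y : ℕ) → Zone
zone k x y =
  if does (x ≤? k)     then (if does (6 * k ≤? 2 * x + y) then z₁ else z₂) else
  if does (x ≤? 3 * k) then (if does (9 * k ≤? x + 2 * y) then z₃ else
                             if does (3 * x + 2 * y ≤? 11 * k + 1) then z₄ else z₅)
  else z₆

module _ (k x y : ℕ) where

  zone-12 : ∀ {z} → x ≤ k → (if does (6 * k ≤? 2 * x + y) then z₁ else z₂) ≡ z → zone k x y ≡ z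
  zone-12 p = trans (if-yes (x ≤? k) p)

  zone-345 : ∀ {z} → k < x → x ≤ 3 * k →
             (if does (9 * k ≤? x + 2 * y) then z₃ else
              if does (3 * x + 2 * y ≤? 11 * k + 1) then z₄ else z₅) ≡ z → zone k x y ≡ z
  zone-345 p p′ eq = trans (if-no (x ≤? k) (<⇒≱ p)) (trans (if-yes (x ≤? 3 * k) p′) eq)

piece-zone : ∀ {z k a b c x y} → Piece z k a b c x y → zone k x y ≡ z
piece-zone {k = k} {x = x} {y = y} (piece₁ m s h) =
  zone-12 k x y (slack m (solve (h ∷ m ∷ s ∷ [])))
      (if-yes (6 * k ≤? 2 * x + y) (slack s (solve (h ∷ m ∷ s ∷ []))))
piece-zone {k = k} {x = x} {y = y} (piece₂ n s u) =
  zone-12 k x y (slack n (solve (n ∷ s ∷ u ∷ []))) (if-no (6 * k ≤? 2 * x + y) (<⇒≱ 2x+y<6k))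
  where
  2x+y<6k : 2 * x + y < 6 * k
  2x+y<6k = slack u (solve (n ∷ s ∷ u ∷ []))
piece-zone {k = k} {x = x} {y = y} (piece₃ b s r e e≤1 g≥1) =
  zone-345 k x y (linear-≤ 0 g≥1 (solve (b ∷ e ∷ r ∷ s ∷ [])))
      (slack (2 * b + e + 2 * s) (solve (b ∷ e ∷ r ∷ s ∷ [])))
      (if-yes (9 * k ≤? x + 2 * y) (slack (2 * b + e) (solve (b ∷ e ∷ r ∷ s ∷ []))))
piece-zone {k = k} {x = x} {y = y} (piece₄ a d r e e≤1 g≥1) =
  zone-345 k x y (linear-≤ 0 g≥1 (solve (a ∷ d ∷ e ∷ r ∷ [])))
      (slack (2 * a + 2 * d + e) (solve (a ∷ d ∷ e ∷ r ∷ [])))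
    (trans (if-no (9 * k ≤? x + 2 * y) (<⇒≱ x+2y<9k))
           (if-yes (3 * x + 2 * y ≤? 11 * k + 1)
               (linear-≤ (2 * d) e≤1 (solve (a ∷ d ∷ e ∷ r ∷ [])))))
  where
  x+2y<9k : x + 2 * y < 9 * k
  x+2y<9k = linear-≤ (2 * d + 2 * r) g≥1 (solve (a ∷ d ∷ e ∷ r ∷ []))
piece-zone {k = k} {x = x} {y = y} (piece₅ a A e ē m s w δ eē δ≤1 p mw) =
  zone-345 k x y (slack (2 * A + s + ē + 1) (solve (A ∷ a ∷ s ∷ ē ∷ [])))
      (linear-≤ m (add-≤ (≤-reflexive eē) (≤-reflexive (sym p)))
      (solve (A ∷ a ∷ e ∷ m ∷ s ∷ ē ∷ [])))
    (trans (if-no (9 * k ≤? x + 2 * y) (<⇒≱ x+2y<9k))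
           (if-no (3 * x + 2 * y ≤? 11 * k + 1) (<⇒≱ 11k+1<3x+2y)))
  where
  x+2y<9k : x + 2 * y < 9 * k
  x+2y<9k = linear-≤ (4 * A + 2 * ē)
      (add-≤ (add-≤ (add-≤ (scale-≤ 3 (≤-reflexive eē)) (≤-reflexive (sym p)))
      (≤-reflexive (sym mw))) δ≤1) (solve (A ∷ a ∷ e ∷ m ∷ s ∷ w ∷ ē ∷ δ ∷ []))
  11k+1<3x+2y : 11 * k + 1 < 3 * x + 2 * y
  11k+1<3x+2y = linear-≤ (2 * s + δ)
      (add-≤ (add-≤ (scale-≤ 3 (≤-reflexive (sym eē))) (≤-reflexive p)) (≤-reflexive mw))
      (solve (A ∷ a ∷ e ∷ m ∷ s ∷ w ∷ ē ∷ δ ∷ []))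
piece-zone {k = k} {x = x} {y = y} (piece₆ a r v e c ρ e≤1 ρ≤2 f≥1 cv) =
  trans (if-no (x ≤? k) (<⇒≱ k<x)) (if-no (x ≤? 3 * k) (<⇒≱ 3k<x))
  where
  k<x : k < x
  k<x = linear-≤ (2 * a + 2 * r + 2 * v) f≥1 (solve (a ∷ r ∷ v ∷ ρ ∷ []))
  3k<x : 3 * k < x
  3k<x = linear-≤ 0 f≥1 (solve (a ∷ r ∷ v ∷ ρ ∷ []))

params-≡ : ∀ {a b c a′ b′ c′ : ℕ} → a ≡ a′ → b ≡ b′ → c ≡ c′ → (a , b , c) ≡ (a′ , b′ , c′)
params-≡ refl refl refl = refl

zone-unique : ∀ {z k a b c x y k′ a′ b′ c′ x′ y′} →
              Piece z k a b c x y → Piece z k′ a′ b′ c′ x′ y′ → k ≡ k′ → x ≡ x′ → y ≡ y′ →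
              (a , b , c) ≡ (a′ , b′ , c′)
zone-unique (piece₁ m s h) (piece₁ m′ s′ h′) k≡ x≡ y≡ =
  params-≡ k≡ (linear-≡ (cong₂ _+_ (cong₂ _+_ (cong (5 *_) (sym k≡)) x≡) y≡)
      (solve (h ∷ h′ ∷ m ∷ m′ ∷ s ∷ s′ ∷ [])))
      (linear-≡ (cong₂ _+_ (cong₂ _+_ (cong (13 *_) k≡) (cong (3 *_) (sym x≡)))
      (cong (2 *_) (sym y≡))) (solve (h ∷ h′ ∷ m ∷ m′ ∷ s ∷ s′ ∷ [])))
zone-unique (piece₂ n s u) (piece₂ n′ s′ u′) k≡ x≡ y≡ =
  params-≡ (linear-≡ (cong₂ _+_ (cong₂ _+_ (cong (5 *_) (sym k≡)) (cong (2 *_) x≡)) y≡)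
      (solve (n ∷ n′ ∷ s ∷ s′ ∷ u ∷ u′ ∷ [])))
      (linear-≡ (cong₂ _+_ (cong₂ _+_ (cong (13 *_) k≡) (cong (5 *_) (sym x≡)))
      (cong (2 *_) (sym y≡))) (solve (n ∷ n′ ∷ s ∷ s′ ∷ u ∷ u′ ∷ [])))
      (linear-≡ (cong₂ _+_ (cong₂ _+_ (cong (5 *_) (sym k≡)) (cong (3 *_) x≡)) y≡)
      (solve (n ∷ n′ ∷ s ∷ s′ ∷ u ∷ u′ ∷ [])))
zone-unique (piece₃ b s r e e≤1 _) (piece₃ b′ s′ r′ e′ e′≤1 _) k≡ x≡ y≡
  with refl , refl ← halves-unique {r} {e} {r′} {e′} e≤1 e′≤1
      (linear-≡ (cong₂ _+_ (sym k≡) x≡) (solve (b ∷ b′ ∷ e ∷ e′ ∷ r ∷ r′ ∷ s ∷ s′ ∷ []))) =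
  params-≡ k≡ (linear-≡ (cong₂ _+_ (cong (4 *_) (sym k≡)) y≡)
      (solve (b ∷ b′ ∷ e ∷ r ∷ s ∷ s′ ∷ [])))
      (linear-≡ (cong₂ _+_ (cong (10 *_) k≡) (cong (2 *_) (sym y≡)))
      (solve (b ∷ b′ ∷ e ∷ r ∷ s ∷ s′ ∷ [])))
zone-unique (piece₄ a d r e e≤1 _) (piece₄ a′ d′ r′ e′ e′≤1 _) k≡ x≡ y≡
  with refl , refl ← halves-unique {r} {e} {r′} {e′} e≤1 e′≤1
      (linear-≡ (cong₂ _+_ (sym k≡) x≡) (solve (a ∷ a′ ∷ d ∷ d′ ∷ e ∷ e′ ∷ r ∷ r′ ∷ []))) =
  params-≡ (linear-≡ (cong₂ _+_ (cong (3 *_) (sym k≡)) y≡) (solve (a ∷ a′ ∷ d ∷ d′ ∷ e ∷ r ∷ [])))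
      (linear-≡ (cong₂ _+_ (cong (8 *_) k≡) (cong (2 *_) (sym y≡)))
      (solve (a ∷ a′ ∷ d ∷ d′ ∷ e ∷ r ∷ [])))
      (linear-≡ (cong₂ _+_ (cong (2 *_) (sym k≡)) y≡) (solve (a ∷ a′ ∷ d ∷ d′ ∷ e ∷ r ∷ [])))
zone-unique (piece₅ a A e ē m s w δ eē δ≤1 p mw) (piece₅ a′ A′ e′ ē′ m′ s′ w′ δ′ eē′ δ′≤1 p′ mw′)
  k≡ x≡ y≡
  with refl ← (m ≡ m′ ∋ (linear-≡
      (cong₂ _+_ (cong₂ _+_ (cong₂ _+_ (cong₂ _+_ (cong₂ _+_ (cong (3 *_) k≡) (sym x≡)) eē)
      (sym eē′)) (sym p)) p′) (solve (A ∷ A′ ∷ a ∷ a′ ∷ e ∷ e′ ∷ m ∷ m′ ∷ s ∷ s′ ∷ ē ∷ ē′ ∷ []))))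
  with refl ← trans (sym (⌈/2⌉-unique m w δ δ≤1 mw)) (⌈/2⌉-unique m w′ δ′ δ′≤1 mw′)
  with refl , refl ← halves-unique {a} {e} {a′} {e′}
      (linear-≤ ē (≤-reflexive eē) (solve (e ∷ ē ∷ [])))
      (linear-≤ ē′ (≤-reflexive eē′) (solve (e′ ∷ ē′ ∷ [])))
      (linear-≡ (cong₂ _+_ (sym k≡) y≡) (solve (A ∷ A′ ∷ a ∷ a′ ∷ e ∷ e′ ∷ w ∷ []))) =
  params-≡ refl refl (linear-≡
      (cong₂ _+_ (cong₂ _+_ (cong (3 *_) k≡) (cong (2 *_) eē)) (cong (2 *_) (sym eē′)))
      (solve (A ∷ A′ ∷ a ∷ e ∷ m ∷ ē ∷ ē′ ∷ [])))
zone-unique (piece₆ a r v e c ρ e≤1 ρ≤2 _ cv) (piece₆ a′ r′ v′ e′ c′ ρ′ e′≤1 ρ′≤2 _ cv′) k≡ x≡ y≡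
  with refl , refl ← thirds-unique {r} {ρ} {r′} {ρ′} ρ≤2 ρ′≤2
      (linear-≡ (cong₂ _+_ (cong (3 *_) (sym k≡)) x≡)
      (solve (a ∷ a′ ∷ r ∷ r′ ∷ v ∷ v′ ∷ ρ ∷ ρ′ ∷ [])))
  with refl , refl ← halves-unique {v} {e′} {v′} {e} e′≤1 e≤1
      (linear-≡ (cong₂ _+_ (cong (3 *_) k≡) (sym y≡)) (solve (a ∷ a′ ∷ e ∷ e′ ∷ r ∷ v ∷ v′ ∷ []))) =
  params-≡ (linear-≡ k≡ (solve (a ∷ a′ ∷ r ∷ v ∷ []))) refl
      (linear-≡ (cong₂ _+_ cv (sym cv′)) (solve (c ∷ c′ ∷ e ∷ v ∷ ρ ∷ [])))

piece-unique : ∀ {z z′ k a b c a′ b′ c′ x y x′ y′} →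
               Piece z k a b c x y → Piece z′ k a′ b′ c′ x′ y′ → (x , y) ≡ (x′ , y′) →
               (a , b , c) ≡ (a′ , b′ , c′)
piece-unique p p′ refl with refl ← trans (sym (piece-zone p)) (piece-zone p′) =
  zone-unique p p′ refl refl refl

∃-offset : ∀ {m n} → m ≤ n → ∃[ o ] m + o ≡ n
∃-offset m≤n = m≤n⇒∃[o]m+o≡n m≤n

offset : ∀ {m n} {A : Set} → m ≤ n → (∀ o → m + o ≡ n → A) → A
offset m≤n f with o , eq ← ∃-offset m≤n = f o eq

halve : ∀ {A : Set} n → (∀ h e → e ≤ 1 → n ≡ 2 * h + e → A) → A
halve n f with h , e , e≤1 , eq ← halves n = f h e e≤1 eq

divide₃ : ∀ {A : Set} n → (∀ h e → e ≤ 2 → n ≡ 3 * h + e → A) → A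
divide₃ n f with h , e , e≤2 , eq ← thirds n = f h e e≤2 eq

cover-a≡k : ∀ k b c → b ≤ k → b + c ≤ 2 * k → ∃ λ z → ∃₂ (Piece z k k b c)
cover-a≡k k b c b≤k b+c≤2k with ∃-offset b≤k
... | h , refl with <-≤-connex c (2 * h)
... | inj₁ c<2h =
  halve c λ s e e≤1 c≡ →
  offset {s + e} {h} (*-cancelˡ-≤ 2
      (linear-≤ 0 (add-≤ (add-≤ c<2h e≤1) (≤-reflexive (sym c≡))) (solve (c ∷ e ∷ h ∷ s ∷ [])))) λ r
      r≡ →
  _ , _ , _ , cast (b + h) (b + h) b c _ _
      (piece₃ b s r e e≤1 (linear-≤ 0
      (add-≤ (add-≤ c<2h (≤-reflexive (sym c≡))) (scale-≤ 2 (≤-reflexive (sym r≡))))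
      (solve (c ∷ e ∷ h ∷ r ∷ s ∷ []))))
    (linear-≡ r≡ (solve (b ∷ e ∷ h ∷ r ∷ s ∷ []))) (linear-≡ r≡ (solve (b ∷ e ∷ h ∷ r ∷ s ∷ [])))
        refl (sym c≡) refl refl
... | inj₂ 2h≤c =
  offset 2h≤c λ m m≡ →
  offset {m} {b} (linear-≤ 0 (add-≤ b+c≤2k (≤-reflexive m≡)) (solve (b ∷ c ∷ h ∷ m ∷ []))) λ s s≡ →
  _ , _ , _ , cast (b + h) (b + h) b c _ _ (piece₁ m s h) (linear-≡ s≡ (solve (b ∷ h ∷ m ∷ s ∷ [])))
      (linear-≡ s≡ (solve (b ∷ h ∷ m ∷ s ∷ []))) s≡ (linear-≡ m≡ (solve (c ∷ h ∷ m ∷ []))) refl refl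

cover-c≡max : ∀ a A b c → a + b ≤ 2 * (a + A + 1) → a + b + c ≡ 3 * (a + A + 1) →
              ∃ λ z → ∃₂ (Piece z (a + A + 1) a b c)
cover-c≡max a A b c a+b≤2k c≡max with <-≤-connex b (2 * A + 2)
... | inj₁ b<2A+2 =
  halve b λ d e e≤1 b≡ →
  offset {d + e} {A + 1} (*-cancelˡ-≤ 2
      (linear-≤ 0 (add-≤ (add-≤ b<2A+2 e≤1) (≤-reflexive (sym b≡))) (solve (A ∷ b ∷ d ∷ e ∷ []))))
      λ r r≡ →
  _ , _ , _ , cast (a + A + 1) a b c _ _
      (piece₄ a d r e e≤1 (linear-≤ 0
      (add-≤ (add-≤ b<2A+2 (scale-≤ 2 (≤-reflexive (sym r≡)))) (≤-reflexive (sym b≡)))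
      (solve (A ∷ b ∷ d ∷ e ∷ r ∷ []))))
    (linear-≡ r≡ (solve (A ∷ a ∷ d ∷ e ∷ r ∷ []))) refl (sym b≡)
        (linear-≡ (cong₂ _+_ (cong₂ _+_ (sym c≡max) (cong (3 *_) r≡)) b≡)
        (solve (A ∷ a ∷ b ∷ c ∷ d ∷ e ∷ r ∷ []))) refl refl
... | inj₂ 2A+2≤b =
  offset 2A+2≤b λ n n≡ →
  offset {n} {a} (linear-≤ 0 (add-≤ a+b≤2k (≤-reflexive n≡)) (solve (A ∷ a ∷ b ∷ n ∷ []))) λ s s≡ →
  _ , _ , _ , cast (a + A + 1) a b c _ _ (piece₂ n s A) (linear-≡ s≡ (solve (A ∷ a ∷ n ∷ s ∷ [])))
      s≡ n≡ (linear-≡ (cong₂ _+_ (cong₂ _+_ (sym c≡max) (sym n≡)) (cong (2 *_) s≡))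
      (solve (A ∷ a ∷ b ∷ c ∷ n ∷ s ∷ []))) refl refl

cover-b≤1 : ∀ a A e c → e ≤ 1 → a + e + c < 3 * (a + A + 1) → ∃ λ z → ∃₂ (Piece z (a + A + 1) a e c)
cover-b≤1 a A e c e≤1 a+e+c< with <-≤-connex (c + 2 * e) (3 * A + 3)
... | inj₁ p =
  offset p λ f f≡ →
  divide₃ (suc f) λ r ρ ρ≤2 r≡ →
  offset {r} {A + 1} (*-cancelˡ-≤ 3
      (linear-≤ (c + 2 * e + ρ) (add-≤ (≤-reflexive f≡) (≤-reflexive (sym r≡)))
      (solve (A ∷ c ∷ e ∷ f ∷ r ∷ ρ ∷ [])))) λ v v≡ →
  _ , _ , _ , cast (a + A + 1) a e c _ _
    (piece₆ a r v e c ρ e≤1 ρ≤2 (linear-≤ f (≤-reflexive r≡) (solve (f ∷ r ∷ ρ ∷ [])))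
        (linear-≡ (cong₂ _+_ (cong₂ _+_ f≡ (sym r≡)) (cong (3 *_) (sym v≡)))
        (solve (A ∷ c ∷ e ∷ f ∷ r ∷ v ∷ ρ ∷ []))))
    (linear-≡ v≡ (solve (A ∷ a ∷ r ∷ v ∷ []))) refl refl refl refl refl
... | inj₂ p =
  offset p λ m m≡ →
  offset e≤1 λ ē ē≡ →
  offset {m + 1} {2 * a + e}
      (linear-≤ 0 (add-≤ a+e+c< (≤-reflexive m≡)) (solve (A ∷ a ∷ c ∷ e ∷ m ∷ []))) λ s s≡ →
  halve (suc m) λ w δ′ δ′≤1 w≡ →
  offset δ′≤1 λ δ δ≡ →
  _ , _ , _ , cast (a + A + 1) a e c _ _
    (piece₅ a A e ē m s w δ ē≡ (linear-≤ δ′ (≤-reflexive δ≡) (solve (δ ∷ δ′ ∷ [])))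
        (linear-≡ (sym s≡) (solve (a ∷ e ∷ m ∷ s ∷ [])))
        (linear-≡ (cong₂ _+_ δ≡ w≡) (solve (m ∷ w ∷ δ ∷ δ′ ∷ []))))
    refl refl refl (linear-≡ (cong₂ _+_ m≡ (cong (2 *_) ē≡)) (solve (A ∷ c ∷ e ∷ m ∷ ē ∷ []))) refl
        refl

unshifted-piece : ∀ {k a b c} → Bounded k a b c → ¬ Shifted k (a , b , c) → ∃ λ z → ∃₂
    (Piece z k a b c)
unshifted-piece {k} {a} {b} {c} (bounded a≤k a+b≤2k a+b+c≤3k) unshifted with m≤n⇒m<n∨m≡n a≤k
... | inj₂ refl = cover-a≡k k b c (linear-≤ 0 a+b≤2k (solve (b ∷ k ∷ [])))
      (linear-≤ 0 a+b+c≤3k (solve (b ∷ c ∷ k ∷ [])))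
... | inj₁ a<k with ∃-offset a<k
...   | A , k≡ with refl ← trans (+-comm (a + A) 1) k≡ with m≤n⇒m<n∨m≡n a+b+c≤3k | b ≤? 1
...     | inj₂ c≡max  | _       = cover-c≡max a A b c a+b≤2k c≡max
...     | inj₁ a+b+c< | yes b≤1 = cover-b≤1 a A b c b≤1 a+b+c<
...     | inj₁ a+b+c< | no b≰1  = contradiction (≰⇒> b≰1 , a<k , a+b+c<) unshifted

HasPiece : ℕ → ℕ → ℕ → Set
HasPiece k x y = ∃ λ z → ∃ λ a → ∃₂ λ b c → Piece z k a b c x y

region-x≤k : ∀ x m y → x + y ≤ 6 * (x + m) → 6 * (x + m) ≤ 3 * x + y → HasPiece (x + m) x y
region-x≤k x m y x+y≤6k 6k≤3x+y with <-≤-connex (2 * x + y) (6 * (x + m))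
... | inj₁ p =
  offset {3 * x + 6 * m} {y} (linear-≤ 0 6k≤3x+y (solve (m ∷ x ∷ y ∷ []))) λ s s≡ →
  offset {suc s} {x} (linear-≤ 0 (add-≤ p (≤-reflexive s≡)) (solve (m ∷ s ∷ x ∷ y ∷ []))) λ u u≡ →
  _ , _ , _ , _ , cast (x + m) _ _ _ x y (piece₂ m s u) (linear-≡ u≡ (solve (m ∷ s ∷ u ∷ x ∷ [])))
      refl refl refl (linear-≡ u≡ (solve (s ∷ u ∷ x ∷ [])))
    (linear-≡ (cong₂ _+_ (cong (3 *_) u≡) s≡) (solve (m ∷ s ∷ u ∷ x ∷ y ∷ [])))
... | inj₂ p =
  offset {4 * x + 6 * m} {y} (linear-≤ 0 p (solve (m ∷ x ∷ y ∷ []))) λ s s≡ →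
  offset {s} {x} (linear-≤ 0 (add-≤ x+y≤6k (≤-reflexive s≡)) (solve (m ∷ s ∷ x ∷ y ∷ []))) λ h h≡ →
  _ , _ , _ , _ , cast (x + m) _ _ _ x y (piece₁ m s h) (linear-≡ h≡ (solve (h ∷ m ∷ s ∷ x ∷ [])))
      refl refl refl h≡
    (linear-≡ (cong₂ _+_ (cong (4 *_) h≡) s≡) (solve (h ∷ m ∷ s ∷ x ∷ y ∷ [])))

module _ (k r e y : ℕ) (e≤1 : e ≤ 1) where

  region₃ : 1 ≤ 2 * r + e → k + 2 * r + e + y ≤ 6 * k → 9 * k ≤ k + 2 * r + e + 2 * y →
            HasPiece k (k + 2 * r + e) y
  region₃ g≥1 x+y≤6k p =
    offset {4 * k} {y + r} (cancel-≤ 2 (linear-≤ 0 (add-≤ p e≤1) (solve (e ∷ k ∷ r ∷ y ∷ [])))) λ b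
        b≡ →
    offset {b + r + e} {k} (linear-≤ 0 (add-≤ (≤-reflexive b≡) x+y≤6k)
        (solve (b ∷ e ∷ k ∷ r ∷ y ∷ []))) λ s s≡ →
    _ , _ , _ , _ , cast k _ _ _ (k + 2 * r + e) y (piece₃ b s r e e≤1 g≥1)
        (linear-≡ s≡ (solve (b ∷ e ∷ k ∷ r ∷ s ∷ []))) refl refl refl
      (linear-≡ s≡ (solve (b ∷ e ∷ k ∷ r ∷ s ∷ [])))
          (linear-≡ (cong₂ _+_ (cong (4 *_) s≡) b≡) (solve (b ∷ e ∷ k ∷ r ∷ s ∷ y ∷ [])))

  region₄ : 1 ≤ 2 * r + e → 3 * k ≤ y + 2 * r → 3 * (k + 2 * r + e) + 2 * y ≤ 11 * k + 1 →
            HasPiece k (k + 2 * r + e) y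
  region₄ g≥1 3k≤y+2r p =
    offset 3k≤y+2r λ a a≡ →
    offset {a + r + e} {k} (cancel-≤ 2
        (linear-≤ e (add-≤ (scale-≤ 2 (≤-reflexive a≡)) p) (solve (a ∷ e ∷ k ∷ r ∷ y ∷ [])))) λ d
        d≡ →
    _ , _ , _ , _ , cast k _ _ _ (k + 2 * r + e) y (piece₄ a d r e e≤1 g≥1)
        (linear-≡ d≡ (solve (a ∷ d ∷ e ∷ k ∷ r ∷ []))) refl refl refl
      (linear-≡ d≡ (solve (a ∷ d ∷ e ∷ k ∷ r ∷ [])))
          (linear-≡ (cong₂ _+_ (cong (3 *_) d≡) a≡) (solve (a ∷ d ∷ e ∷ k ∷ r ∷ y ∷ [])))

  region₅ : k + 2 * r + e ≤ 3 * k → k + 2 * r + e + 2 * y < 9 * k → 11 * k + 1 < 3 * (k + 2 * r + e)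
      + 2 * y →
            HasPiece k (k + 2 * r + e) y
  region₅ x≤3k p p′ =
    offset {r} {k} (*-cancelˡ-≤ 2 (linear-≤ e x≤3k (solve (e ∷ k ∷ r ∷ [])))) λ w w≡ →
    offset {e} {2 * w} (linear-≤ 0 (add-≤ x≤3k (scale-≤ 2 (≤-reflexive (sym w≡))))
        (solve (e ∷ k ∷ r ∷ w ∷ []))) λ m m≡ →
    offset {2 * k} {y + r} (*-cancelˡ-≤ 2
        (linear-≤ 1 (add-≤ (add-≤ (scale-≤ 2 x≤3k) p′) e≤1) (solve (e ∷ k ∷ r ∷ y ∷ [])))) λ n n≡ →
    offset {m + 1} {n} (cancel-≤ 2
        (linear-≤ 0 (add-≤ (add-≤ (add-≤
        (add-≤ (scale-≤ 2 (≤-reflexive m≡)) (scale-≤ 2 (≤-reflexive (sym n≡))))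
        (scale-≤ 4 (≤-reflexive w≡))) p′) e≤1) (solve (e ∷ k ∷ m ∷ n ∷ r ∷ w ∷ y ∷ [])))) λ s s≡ →
    halve n λ a ε ε≤1 ε≡ →
    offset {a + 1} {k} (cancel-≤ 4
        (linear-≤ (e + 2 * ε) (add-≤
        (add-≤ (scale-≤ 2 (≤-reflexive (sym ε≡))) (scale-≤ 2 (≤-reflexive n≡))) p)
        (solve (a ∷ e ∷ k ∷ n ∷ r ∷ y ∷ ε ∷ [])))) λ A A≡ →
    offset ε≤1 λ ω ω≡ →
    _ , _ , _ , _ , cast k _ _ _ (k + 2 * r + e) y
      (piece₅ a A ε ω m s w e ω≡ e≤1
          (linear-≡ (cong₂ _+_ (sym ε≡) (sym s≡)) (solve (a ∷ m ∷ n ∷ s ∷ ε ∷ [])))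
          (linear-≡ m≡ (solve (e ∷ m ∷ w ∷ []))))
      (linear-≡ A≡ (solve (A ∷ a ∷ k ∷ []))) refl refl refl
      (linear-≡ (cong₂ _+_ (cong₂ _+_
          (cong₂ _+_ (cong₂ _+_ (cong₂ _+_ (cong (3 *_) A≡) (sym m≡)) ω≡) (cong (2 *_) (sym w≡)))
          ε≡) s≡) (solve (A ∷ a ∷ e ∷ k ∷ m ∷ n ∷ r ∷ s ∷ w ∷ ε ∷ ω ∷ [])))
      (linear-≡ (cong₂ _+_ (cong₂ _+_ (cong₂ _+_ A≡ (sym ε≡)) n≡) w≡)
          (solve (A ∷ a ∷ k ∷ n ∷ r ∷ w ∷ y ∷ ε ∷ [])))

region₆ : ∀ k r ρ y → ρ ≤ 2 → 1 ≤ 3 * r + ρ → 3 * k + 3 * r + ρ + y ≤ 6 * k →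
          6 * k ≤ 3 * k + 3 * r + ρ + 3 * y → HasPiece k (3 * k + 3 * r + ρ) y
region₆ k r ρ y ρ≤2 f≥1 x+y≤6k 6k≤x+3y =
  offset {y + r} {3 * k} (linear-≤ (2 * r + ρ) x+y≤6k (solve (k ∷ r ∷ y ∷ ρ ∷ []))) λ n n≡ →
  halve (suc n) λ A ē ē≤1 A≡ →
  offset ē≤1 λ e e≡ →
  offset {A} {k} (cancel-≤ 6
      (linear-≤ (3 * ē) (add-≤ (add-≤
      (add-≤ (scale-≤ 3 (≤-reflexive n≡)) (scale-≤ 3 (≤-reflexive (sym A≡)))) 6k≤x+3y) ρ≤2)
      (solve (A ∷ k ∷ n ∷ r ∷ y ∷ ē ∷ ρ ∷ [])))) λ a a≡ →
  offset {r} {A} (*-cancelˡ-≤ 2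
      (linear-≤ ρ (add-≤ (add-≤ (add-≤ (≤-reflexive (sym n≡)) (≤-reflexive A≡)) x+y≤6k) ē≤1)
      (solve (A ∷ k ∷ n ∷ r ∷ y ∷ ē ∷ ρ ∷ [])))) λ v v≡ →
  offset {2 * e + ρ} {3 * v}
      (2e+ρ≤3v e v (linear-≤ 0 (add-≤
      (add-≤ (add-≤ (add-≤ (≤-reflexive (sym n≡)) (≤-reflexive A≡)) (≤-reflexive e≡))
      (scale-≤ 2 (≤-reflexive (sym v≡)))) x+y≤6k) (solve (A ∷ e ∷ k ∷ n ∷ r ∷ v ∷ y ∷ ē ∷ ρ ∷ [])))
      (linear-≤ ē (≤-reflexive e≡) (solve (e ∷ ē ∷ [])))) λ c c≡ →
  _ , _ , _ , _ , cast k _ _ _ (3 * k + 3 * r + ρ) y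
    (piece₆ a r v e c ρ (linear-≤ ē (≤-reflexive e≡) (solve (e ∷ ē ∷ []))) ρ≤2 f≥1
        (linear-≡ c≡ (solve (c ∷ e ∷ v ∷ ρ ∷ []))))
    (linear-≡ (cong₂ _+_ a≡ v≡) (solve (A ∷ a ∷ k ∷ r ∷ v ∷ []))) refl refl refl
    (linear-≡ (cong₂ _+_ (cong (3 *_) a≡) (cong (3 *_) v≡)) (solve (A ∷ a ∷ k ∷ r ∷ v ∷ ρ ∷ [])))
    (linear-≡ (cong₂ _+_ (cong₂ _+_ (cong₂ _+_ (cong₂ _+_ (cong (3 *_) a≡) v≡) A≡) e≡) (sym n≡))
        (solve (A ∷ a ∷ e ∷ k ∷ n ∷ r ∷ v ∷ y ∷ ē ∷ [])))
  where
  2e+ρ≤3v : ∀ e v → ρ + e ≤ 2 * v → e ≤ 1 → 2 * e + ρ ≤ 3 * v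
  2e+ρ≤3v e v ρ+e≤2v e≤1 = linear-≤ 0 (add-≤ ρ+e≤2v e≤v) (solve (e ∷ v ∷ ρ ∷ []))
    where
    e≤v : e ≤ v
    e≤v = cancel-≤ 2 (linear-≤ ρ (add-≤ ρ+e≤2v e≤1) (solve (e ∷ v ∷ ρ ∷ [])))

parity-bound : ∀ k r e y → e ≤ 1 → 4 * k ≤ k + 2 * r + e + y →
               (k + 2 * r + e + y ≡ 4 * k → 2 ∣ k + 2 * r + e + k) → 3 * k ≤ y + 2 * r
parity-bound k r zero       y _ p even = linear-≤ 0 p (solve (k ∷ r ∷ y ∷ []))
parity-bound k r (suc zero) y _ p even with m≤n⇒m<n∨m≡n p
... | inj₁ lt = linear-≤ 0 lt (solve (k ∷ r ∷ y ∷ []))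
... | inj₂ eq = contradiction (even (sym eq))
      (odd⇒2∤ (k + 2 * r + 1 + k) (k + r) (solve (k ∷ r ∷ [])))
parity-bound k r (suc (suc e)) y (s≤s ()) p even

region-piece : ∀ {k x y} → Region k x y → HasPiece k x y
region-piece {k} {x} {y} (region x+y≤ ≤3x+y ≤x+3y ≤x+y even) with x ≤? k
... | yes x≤k with m , refl ← ∃-offset x≤k = region-x≤k x m y x+y≤ ≤3x+y
... | no x≰k with x ≤? 3 * k
region-piece {k} {x} {y} (region x+y≤ ≤3x+y ≤x+3y ≤x+y even) | no x≰k | no x≰3k
  with f , f≡ ← ∃-offset (≰⇒> x≰3k) with r , ρ , ρ≤2 , r≡ ← thirds (suc f)
  with refl ← (3 * k + 3 * r + ρ ≡ x ∋
      (linear-≡ (cong₂ _+_ f≡ (sym r≡)) (solve (f ∷ k ∷ r ∷ x ∷ ρ ∷ [])))) = region₆ k r ρ y ρ≤2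
      (linear-≤ f (≤-reflexive r≡) (solve (f ∷ r ∷ ρ ∷ []))) x+y≤ ≤x+3y
region-piece {k} {x} {y} (region x+y≤ ≤3x+y ≤x+3y ≤x+y even) | no x≰k | yes x≤3k
  with f , f≡ ← ∃-offset (≰⇒> x≰k) with r , e , e≤1 , r≡ ← halves (suc f)
  with refl ← (k + 2 * r + e ≡ x ∋
      (linear-≡ (cong₂ _+_ f≡ (sym r≡)) (solve (e ∷ f ∷ k ∷ r ∷ x ∷ []))))
  with 9 * k ≤? k + 2 * r + e + 2 * y | 3 * (k + 2 * r + e) + 2 * y ≤? 11 * k + 1
...   | yes p | _      = region₃ k r e y e≤1 (linear-≤ f (≤-reflexive r≡) (solve (e ∷ f ∷ r ∷ [])))
      x+y≤ p
...   | no  _ | yes p  = region₄ k r e y e≤1 (linear-≤ f (≤-reflexive r≡) (solve (e ∷ f ∷ r ∷ [])))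
      (parity-bound k r e y e≤1 ≤x+y even) p
...   | no ¬p | no ¬p′ = region₅ k r e y e≤1 x≤3k (≰⇒> ¬p) (≰⇒> ¬p′)

-- Raising b by two and k by one

module _ {P Q : Set} {x y x′ y′ : ℕ} where

  if-shift : (P? : Dec P) (Q? : Dec Q) → (P → Q) → (Q → P) → (P → x′ ≡ 2 + x) → (¬ P → y′ ≡ 2 + y) →
             (if does Q? then x′ else y′) ≡ 2 + (if does P? then x else y)
  if-shift (yes p) Q? P⇒Q Q⇒P x≡ y≡ = trans (if-yes Q? (P⇒Q p)) (x≡ p)
  if-shift (no ¬p) Q? P⇒Q Q⇒P x≡ y≡ = trans (if-no Q? (¬p ∘ Q⇒P)) (y≡ ¬p)

if-≤-shift : ∀ n l r l′ r′ {x y x′ y′} → l′ ≡ n + l → r′ ≡ n + r →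
             (l ≤ r → x′ ≡ 2 + x) → (¬ l ≤ r → y′ ≡ 2 + y) →
             (if does (l′ ≤? r′) then x′ else y′) ≡ 2 + (if does (l ≤? r) then x else y)
if-≤-shift n l r _ _ refl refl =
  if-shift (l ≤? r) (n + l ≤? n + r) (+-monoʳ-≤ n) (+-cancelˡ-≤ n l r)

∸-shift : ∀ n l r l′ r′ → r ≤ l → l′ ≡ 2 + (n + l) → r′ ≡ n + r → l′ ∸ r′ ≡ 2 + (l ∸ r)
∸-shift n l r _ _ r≤l l′≡ refl = trans
  (cong (_∸ (n + r)) (trans l′≡
      (trans (sym (+-assoc 2 n l)) (trans (cong (_+ l) (+-comm 2 n)) (+-assoc n 2 l)))))
  (trans ([m+n]∸[m+o]≡n∸o n (2 + l) r) (+-∸-assoc 2 r≤l))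

[2+n]/2 : ∀ n → (2 + n) / 2 ≡ suc (n / 2)
[2+n]/2 n = +-distrib-/-∣ˡ {2} n (divides 1 refl)

module _ (k a b c : ℕ) where

  shift₁ : 2 * k ≤ 2 * a + b → bounce₁ (suc k) (a , 2 + b , c) ≡ 2 + bounce₁ k (a , b , c)
  shift₁ p = if-≤-shift 4 (4 * k) (2 * a + 2 * b + c) (4 * suc k) (2 * a + 2 * (2 + b) + c)
      (solve (k ∷ [])) (solve (a ∷ b ∷ c ∷ []))
    (λ p′ → ∸-shift 4 (6 * a + 3 * b + c) (4 * k) (6 * a + 3 * (2 + b) + c) (4 * suc k)
        (linear-≤ (4 * a + b) p′ (solve (a ∷ b ∷ c ∷ k ∷ [])))
              (solve (a ∷ b ∷ c ∷ [])) (solve (k ∷ [])))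
    (λ _ → ∸-shift 2 (5 * a + 2 * b + ⌈ c /2⌉) (2 * k) (5 * a + 2 * (2 + b) + ⌈ c /2⌉) (2 * suc k)
        (≤-trans p (≤-trans 2a+b≤ (m≤m+n _ ⌈ c /2⌉)))
             (cong (_+ ⌈ c /2⌉) 5a+2[2+b]≡) (solve (k ∷ [])))
    where
    2a+b≤ : 2 * a + b ≤ 5 * a + 2 * b
    2a+b≤ = slack (3 * a + b) (solve (a ∷ b ∷ []))
    5a+2[2+b]≡ : 5 * a + 2 * (2 + b) ≡ 4 + (5 * a + 2 * b)
    5a+2[2+b]≡ = solve (a ∷ b ∷ [])

  shift₂ : bounce₂ (suc k) (a , 2 + b , c) ≡ 2 + bounce₂ k (a , b , c)
  shift₂ rewrite [2+n]/2 b = go (b / 2) (m/n*n≤m b 2)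
    where
    go : ∀ e → e * 2 ≤ b →
         (if does (3 * suc k ≤? a + 3 * suc e + c) then 4 * a + 2 * (2 + b) + c ∸ 2 * suc k
          else if does (3 * suc k ≤? 3 * a + 3 * suc e + c)
          then 2 * a + suc e + suc k + ⌈ 3 * a + 3 * suc e + c ∸ 3 * suc k /2⌉
          else 3 * a + (2 + b) + ⌈ c /3⌉) ≡
         2 + (if does (3 * k ≤? a + 3 * e + c) then 4 * a + 2 * b + c ∸ 2 * k
              else if does (3 * k ≤? 3 * a + 3 * e + c)
              then 2 * a + e + k + ⌈ 3 * a + 3 * e + c ∸ 3 * k /2⌉
              else 3 * a + b + ⌈ c /3⌉)
    go e e≤ = if-≤-shift 3 (3 * k) (a + 3 * e + c) (3 * suc k) (a + 3 * suc e + c) (solve (k ∷ []))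
        (solve (a ∷ c ∷ e ∷ []))
      (λ p → ∸-shift 2 (4 * a + 2 * b + c) (2 * k) (4 * a + 2 * (2 + b) + c) (2 * suc k)
          (linear-≤ (3 * a + e + k) (add-≤ p (scale-≤ 2 e≤)) (solve (a ∷ b ∷ c ∷ e ∷ k ∷ [])))
               (solve (a ∷ b ∷ c ∷ [])) (solve (k ∷ [])))
      (λ _ → if-≤-shift 3 (3 * k) (3 * a + 3 * e + c) (3 * suc k) (3 * a + 3 * suc e + c)
          (solve (k ∷ [])) 3a+3[1+e]+c≡
        (λ _ → cong₂ _+_ 2a+[1+e]+[1+k]≡ (cong ⌈_/2⌉ (trans (cong₂ _∸_ 3a+3[1+e]+c≡ 3[1+k]≡)
                 ([m+n]∸[m+o]≡n∸o 3 (3 * a + 3 * e + c) (3 * k)))))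
        (λ _ → cong (_+ ⌈ c /3⌉) 3a+[2+b]≡))
      where
      3a+3[1+e]+c≡ : 3 * a + 3 * suc e + c ≡ 3 + (3 * a + 3 * e + c)
      3a+3[1+e]+c≡ = solve (a ∷ c ∷ e ∷ [])
      3[1+k]≡ : 3 * suc k ≡ 3 + 3 * k
      3[1+k]≡ = solve (k ∷ [])
      2a+[1+e]+[1+k]≡ : 2 * a + suc e + suc k ≡ 2 + (2 * a + e + k)
      2a+[1+e]+[1+k]≡ = solve (a ∷ e ∷ k ∷ [])
      3a+[2+b]≡ : 3 * a + (2 + b) ≡ 2 + (3 * a + b)
      3a+[2+b]≡ = solve (a ∷ b ∷ [])

  shift₃ : bounce₃ (suc k) (a , 2 + b , c) ≡ 2 + bounce₃ k (a , b , c)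
  shift₃ rewrite [2+n]/2 (b + 1) = go ((b + 1) / 2) (m/n*n≤m (b + 1) 2)
    where
    go : ∀ e → e * 2 ≤ b + 1 →
         (if does (3 * suc k + 1 ≤? a + 3 * suc e + c) then 4 * a + 2 * (2 + b) + c + 1 ∸ 2 * suc k
          else if does (3 * suc k + 1 ≤? 3 * a + 3 * suc e + c)
          then 2 * a + suc e + suc k + ⌈ 3 * a + 3 * suc e + c ∸ 3 * suc k ∸ 1 /2⌉
          else 3 * a + (2 + b) + 1 + ⌈ c ∸ 1 /3⌉) ≡
         2 + (if does (3 * k + 1 ≤? a + 3 * e + c) then 4 * a + 2 * b + c + 1 ∸ 2 * k
              else if does (3 * k + 1 ≤? 3 * a + 3 * e + c)
              then 2 * a + e + k + ⌈ 3 * a + 3 * e + c ∸ 3 * k ∸ 1 /2⌉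
              else 3 * a + b + 1 + ⌈ c ∸ 1 /3⌉)
    go e e≤ = if-≤-shift 3 (3 * k + 1) (a + 3 * e + c) (3 * suc k + 1) (a + 3 * suc e + c)
        (solve (k ∷ [])) (solve (a ∷ c ∷ e ∷ []))
      (λ p → ∸-shift 2 (4 * a + 2 * b + c + 1) (2 * k) (4 * a + 2 * (2 + b) + c + 1) (2 * suc k)
          (linear-≤ (3 * a + e + k) (add-≤ p (scale-≤ 2 e≤)) (solve (a ∷ b ∷ c ∷ e ∷ k ∷ [])))
               (solve (a ∷ b ∷ c ∷ [])) (solve (k ∷ [])))
      (λ _ → if-≤-shift 3 (3 * k + 1) (3 * a + 3 * e + c) (3 * suc k + 1) (3 * a + 3 * suc e + c)
          (solve (k ∷ [])) 3a+3[1+e]+c≡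
        (λ _ → cong₂ _+_ 2a+[1+e]+[1+k]≡
            (cong (λ n → ⌈ n ∸ 1 /2⌉) (trans (cong₂ _∸_ 3a+3[1+e]+c≡ 3[1+k]≡)
                 ([m+n]∸[m+o]≡n∸o 3 (3 * a + 3 * e + c) (3 * k)))))
        (λ _ → cong (_+ ⌈ c ∸ 1 /3⌉) 3a+[2+b]+1≡))
      where
      3a+3[1+e]+c≡ : 3 * a + 3 * suc e + c ≡ 3 + (3 * a + 3 * e + c)
      3a+3[1+e]+c≡ = solve (a ∷ c ∷ e ∷ [])
      3[1+k]≡ : 3 * suc k ≡ 3 + 3 * k
      3[1+k]≡ = solve (k ∷ [])
      2a+[1+e]+[1+k]≡ : 2 * a + suc e + suc k ≡ 2 + (2 * a + e + k)
      2a+[1+e]+[1+k]≡ = solve (a ∷ e ∷ k ∷ [])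
      3a+[2+b]+1≡ : 3 * a + (2 + b) + 1 ≡ 2 + (3 * a + b + 1)
      3a+[2+b]+1≡ = solve (a ∷ b ∷ [])

  bounce-shift : bounce (suc k) (a , 2 + b , c) ≡ 2 + bounce k (a , b , c)
  bounce-shift = if-≤-shift 2 (2 * k) (2 * a + b) (2 * suc k) (2 * a + (2 + b)) (solve (k ∷ []))
      (solve (a ∷ b ∷ [])) shift₁
    (λ _ → if-shift (2 ∣? b) (2 ∣? 2 + b) (∣m∣n⇒∣m+n ∣-refl) (λ 2∣2+b → ∣m+n∣m⇒∣n 2∣2+b ∣-refl)
      (λ _ → shift₂) (λ _ → shift₃))

  area-shift : Bounded k a b c → area (suc k) (a , 2 + b , c) ≡ 2 + area k (a , b , c)
  area-shift (bounded a≤k a+b≤2k a+b+c≤3k) =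
    offset {3 * a + 2 * b + c} {6 * k}
        (linear-≤ 0 (add-≤ (add-≤ a≤k a+b≤2k) a+b+c≤3k) (solve (a ∷ b ∷ c ∷ k ∷ []))) λ x x≡ →
    trans (area-≡ (suc k) a (2 + b) c {2 + x} (6[1+k]≡ x x≡))
        (cong (2 +_) (sym (area-≡ k a b c {x} (sym x≡))))
    where
    6[1+k]≡ : ∀ x → 3 * a + 2 * b + c + x ≡ 6 * k → 6 * suc k ≡ 3 * a + 2 * (2 + b) + c + (2 + x)
    6[1+k]≡ x x≡ = linear-≡ (sym x≡) (solve (a ∷ b ∷ c ∷ k ∷ x ∷ []))

-- Lists of paths and lists of weights

∈𝒟⇒Bounded : ∀ {k a b c} → (a , b , c) ∈ 𝒟 k → Bounded k a b c
∈𝒟⇒Bounded {k} {a} {b} {c} D∈ with a≤k , b≤ , c≤ ← ∈𝒟⁻ k D∈ = bounded a≤k a+b≤2k a+b+c≤3k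
  where
  b+a≤2k : b + a ≤ 2 * k
  b+a≤2k = m≤o∸n⇒m+n≤o b (≤-trans a≤k (m≤m+n k _)) b≤
  a+b≤2k : a + b ≤ 2 * k
  a+b≤2k = subst (_≤ 2 * k) (+-comm b a) b+a≤2k
  a+b≤3k : a + b ≤ 3 * k
  a+b≤3k = ≤-trans a+b≤2k (m≤n+m (2 * k) k)
  a+b+c≤3k : a + b + c ≤ 3 * k
  a+b+c≤3k = subst (_≤ 3 * k) (+-comm c (a + b))
    (m≤o∸n⇒m+n≤o c a+b≤3k (subst (c ≤_) (∸-+-assoc (3 * k) a b) c≤))

Bounded⇒∈𝒟 : ∀ {k a b c} → Bounded k a b c → (a , b , c) ∈ 𝒟 k
Bounded⇒∈𝒟 {k} {a} {b} {c} (bounded a≤k a+b≤2k a+b+c≤3k) = ∈𝒟⁺ a≤k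
  (m+n≤o⇒m≤o∸n b (subst (_≤ 2 * k) (+-comm a b) a+b≤2k))
  (subst (c ≤_) (sym (∸-+-assoc (3 * k) a b))
      (m+n≤o⇒m≤o∸n c (subst (_≤ 3 * k) (+-comm (a + b) c) a+b+c≤3k)))

module _ {A B : Set} where

  concatMap-unique : (f : A → List B) (g : B → A) {xs : List A} →
                     (∀ {x y} → y ∈ f x → g y ≡ x) → (∀ x → Unique (f x)) →
                     Unique xs → Unique (concatMap f xs)
  concatMap-unique f g {[]}     gf≡ uf u = AllPairs.[]
  concatMap-unique f g {x ∷ xs} gf≡ uf (x∉xs AllPairs.∷ u) =
    Unique.++⁺ (uf x) (concatMap-unique f g gf≡ uf u) disjoint
    where
    disjoint : ∀ {y} → ¬ (y ∈ f x × y ∈ concatMap f xs)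
    disjoint (y∈fx , y∈) with x′ , x′∈ , y∈fx′ ← find (∈-concatMap⁻ f {xs = xs} y∈) =
      All.lookup x∉xs x′∈ (trans (sym (gf≡ y∈fx)) (gf≡ y∈fx′))

  map-unique : {f : A → B} {xs : List A} → (∀ {x y} → x ∈ xs → y ∈ xs → f x ≡ f y → x ≡ y) →
               Unique xs → Unique (map f xs)
  map-unique {f} {[]}     inj u = AllPairs.[]
  map-unique {f} {x ∷ xs} inj (x∉xs AllPairs.∷ u) =
    Allₚ.map⁺ (All.tabulate λ y∈ eq → All.lookup x∉xs y∈ (inj (here refl) (there y∈) eq)) AllPairs.∷
    map-unique (λ x∈ y∈ → inj (there x∈) (there y∈)) u

unique-⊆⇒↭ : {A : Set} {xs ys : List A} → Unique xs → Unique ys →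
             (∀ {x} → x ∈ xs → x ∈ ys) → (∀ {x} → x ∈ ys → x ∈ xs) → xs ↭ ys
unique-⊆⇒↭ u u′ xs⊆ys ys⊆xs = ∼bag⇒↭ (unique∧set⇒bag u u′ (mk⇔ xs⊆ys ys⊆xs))

𝒟-unique : ∀ k → Unique (𝒟 k)
𝒟-unique k = concatMap-unique (𝒟ᵃ k) proj₁ {upTo (suc k)} a≡ 𝒟ᵃ-unique (Unique.upTo⁺ (suc k))
  where
  b≡ : ∀ {a b D} → D ∈ 𝒟ᵃᵇ k a b → proj₁ (proj₂ D) ≡ b
  b≡ {a} {b} D∈ with _ , _ , refl ← ∈-map⁻ (λ c → (a , b , c)) D∈ = refl
  a≡ : ∀ {a D} → D ∈ 𝒟ᵃ k a → proj₁ D ≡ a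
  a≡ {a} D∈ with b , _ , D∈′ ← find (∈-concatMap⁻ (𝒟ᵃᵇ k a) {xs = upTo (suc (2 * k ∸ a))} D∈)
    with _ , _ , refl ← ∈-map⁻ (λ c → (a , b , c)) D∈′ = refl
  𝒟ᵃ-unique : ∀ a → Unique (𝒟ᵃ k a)
  𝒟ᵃ-unique a = concatMap-unique (𝒟ᵃᵇ k a) (proj₁ ∘ proj₂) {upTo (suc (2 * k ∸ a))} b≡
    (λ b → Unique.map⁺ (λ { refl → refl }) (Unique.upTo⁺ (suc (3 * k ∸ a ∸ b))))
        (Unique.upTo⁺ (suc (2 * k ∸ a)))

shifted? : ∀ k D → Dec (Shifted k D)
shifted? k (a , b , c) = (2 ≤? b) ×-dec (a <? k) ×-dec (a + b + c <? 3 * k)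

unshifted : ℕ → List Params
unshifted k = filter (¬? ∘ shifted? k) (𝒟 k)

shift : Params → Params
shift (a , b , c) = a , 2 + b , c

shift-bounded : ∀ {k a b c} → Bounded k a b c →
                Bounded (suc k) a (2 + b) c × Shifted (suc k) (a , 2 + b , c)
shift-bounded {k} {a} {b} {c} (bounded a≤k a+b≤2k a+b+c≤3k) =
  bounded (m≤n⇒m≤1+n a≤k) (linear-≤ 0 a+b≤2k (solve (a ∷ b ∷ k ∷ [])))
      (linear-≤ 1 a+b+c≤3k (solve (a ∷ b ∷ c ∷ k ∷ []))) ,
  m≤m+n 2 b , s≤s a≤k , (linear-≤ 0 a+b+c≤3k (solve (a ∷ b ∷ c ∷ k ∷ [])))

unshift-bounded : ∀ {k a b c} → Bounded (suc k) a (2 + b) c → Shifted (suc k) (a , 2 + b , c) →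
                  Bounded k a b c
unshift-bounded {k} {a} {b} {c} (bounded _ a+b≤ _) (_ , a<1+k , a+b+c<) =
  bounded (s≤s⁻¹ a<1+k) (linear-≤ 0 a+b≤ (solve (a ∷ b ∷ k ∷ [])))
      (linear-≤ 0 a+b+c< (solve (a ∷ b ∷ c ∷ k ∷ [])))

shift-∈𝒟 : ∀ {k D} → D ∈ 𝒟 k → shift D ∈ 𝒟 (suc k) × Shifted (suc k) (shift D)
shift-∈𝒟 D∈ = map₁ Bounded⇒∈𝒟 (shift-bounded (∈𝒟⇒Bounded D∈))

unshift-∈𝒟 : ∀ {k D} → D ∈ 𝒟 (suc k) → Shifted (suc k) D → D ∈ map shift (𝒟 k)
unshift-∈𝒟 {D = a , suc (suc b) , c} D∈ s = ∈-map⁺ shift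
    (Bounded⇒∈𝒟 (unshift-bounded (∈𝒟⇒Bounded D∈) s))
unshift-∈𝒟 {D = a , suc zero , c}    D∈ (s≤s () , _)

𝒟-split : ∀ k → 𝒟 (suc k) ↭ map shift (𝒟 k) ++ unshifted (suc k)
𝒟-split k = unique-⊆⇒↭ (𝒟-unique (suc k))
  (Unique.++⁺ (Unique.map⁺ (λ { refl → refl }) (𝒟-unique k))
      (Unique.filter⁺ (¬? ∘ shifted? (suc k)) (𝒟-unique (suc k))) disjoint)
  split unsplit
  where
  disjoint : ∀ {D} → ¬ (D ∈ map shift (𝒟 k) × D ∈ unshifted (suc k))
  disjoint (D∈ , D∈′) with D , D∈𝒟 , refl ← ∈-map⁻ shift D∈ =
    proj₂ (∈-filter⁻ (¬? ∘ shifted? (suc k)) {xs = 𝒟 (suc k)} D∈′) (proj₂ (shift-∈𝒟 D∈𝒟))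
  split : ∀ {D} → D ∈ 𝒟 (suc k) → D ∈ map shift (𝒟 k) ++ unshifted (suc k)
  split {D} D∈ with shifted? (suc k) D
  ... | yes s = ∈-++⁺ˡ (unshift-∈𝒟 D∈ s)
  ... | no ¬s = ∈-++⁺ʳ (map shift (𝒟 k)) (∈-filter⁺ (¬? ∘ shifted? (suc k)) D∈ ¬s)
  unsplit : ∀ {D} → D ∈ map shift (𝒟 k) ++ unshifted (suc k) → D ∈ 𝒟 (suc k)
  unsplit D∈ with ∈-++⁻ (map shift (𝒟 k)) D∈
  ... | inj₁ D∈′ with D , D∈𝒟 , refl ← ∈-map⁻ shift D∈′ = proj₁ (shift-∈𝒟 D∈𝒟)
  ... | inj₂ D∈′ = proj₁ (∈-filter⁻ (¬? ∘ shifted? (suc k)) {xs = 𝒟 (suc k)} D∈′)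

∈unshifted⁻ : ∀ {k a b c} → (a , b , c) ∈ unshifted k → ∃ λ z → ∃₂ (Piece z k a b c)
∈unshifted⁻ {k} D∈ with D∈𝒟 , ¬s ← ∈-filter⁻ (¬? ∘ shifted? k) {xs = 𝒟 k} D∈ =
  unshifted-piece (∈𝒟⇒Bounded D∈𝒟) ¬s

∈unshifted⁺ : ∀ {z k a b c x y} → Piece z k a b c x y → (a , b , c) ∈ unshifted k
∈unshifted⁺ {k = k} p = ∈-filter⁺ (¬? ∘ shifted? k) (Bounded⇒∈𝒟 (piece-bounded p))
    (piece-unshifted p)

weight-injective : ∀ {k D D′} → D ∈ unshifted k → D′ ∈ unshifted k →
                   weight k D ≡ weight k D′ → D ≡ D′
weight-injective {k} D∈ D′∈ eq =
  let _ , _ , _ , p  = ∈unshifted⁻ {k} D∈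
      _ , _ , _ , p′ = ∈unshifted⁻ {k} D′∈
  in piece-unique p p′ (trans (sym (piece-weight p)) (trans eq (piece-weight p′)))

Symmetric : List (ℕ × ℕ) → Set
Symmetric ws = ws ↭ map swap ws

swap-∈ : ∀ {k w} → w ∈ map (weight k) (unshifted k) → swap w ∈ map (weight k) (unshifted k)
swap-∈ {k} w∈ with D , D∈ , refl ← ∈-map⁻ (weight k) {xs = unshifted k} w∈ =
  let _ , _ , _ , p = ∈unshifted⁻ {k} D∈
      _ , _ , _ , _ , p′ = region-piece (Region-sym (piece-region p))
  in subst (_∈ map (weight k) (unshifted k))
      (trans (piece-weight p′) (cong swap (sym (piece-weight p))))
       (∈-map⁺ (weight k) (∈unshifted⁺ p′))

unshifted-symmetric : ∀ k → Symmetric (map (weight k) (unshifted k))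
unshifted-symmetric k = unique-⊆⇒↭ unique (Unique.map⁺ (cong swap) unique)
    (∈-map⁺ swap ∘ swap-∈ {k}) swap⊆
  where
  unique : Unique (map (weight k) (unshifted k))
  unique = map-unique (weight-injective {k}) (Unique.filter⁺ (¬? ∘ shifted? k) (𝒟-unique k))
  swap⊆ : ∀ {w} → w ∈ map swap (map (weight k) (unshifted k)) → w ∈ map (weight k) (unshifted k)
  swap⊆ w∈ with _ , w′∈ , refl ← ∈-map⁻ swap w∈ = swap-∈ {k} w′∈

2+² : ℕ × ℕ → ℕ × ℕ
2+² (i , j) = 2 + i , 2 + j

weight-shift : ∀ k → map (weight (suc k)) (map shift (𝒟 k)) ≡ map 2+² (map (weight k) (𝒟 k))
weight-shift k = trans (sym (map-∘ (𝒟 k))) (trans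
  (map-cong-local (All.tabulate λ {D} → shift-weight D)) (map-∘ (𝒟 k)))
  where
  shift-weight : ∀ D → D ∈ 𝒟 k → weight (suc k) (shift D) ≡ 2+² (weight k D)
  shift-weight (a , b , c) D∈ = cong₂ _,_ (area-shift k a b c (∈𝒟⇒Bounded D∈))
      (bounce-shift k a b c)

weights-symmetric : ∀ k → Symmetric (map (weight k) (𝒟 k))
weights-symmetric zero    = ↭.refl
weights-symmetric (suc k) = begin
  map (weight (suc k)) (𝒟 (suc k))       ↭⟨ 𝒟↭ ⟩
  map 2+² ws ++ ws′                      ↭⟨ ++⁺ (map⁺ 2+² (weights-symmetric k)) ws′-symmetric ⟩
  map 2+² (map swap ws) ++ map swap ws′  ≡⟨ cong (_++ map swap ws′) swap-2+² ⟩
  map swap (map 2+² ws) ++ map swap ws′  ≡⟨ map-++ swap (map 2+² ws) ws′ ⟨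
  map swap (map 2+² ws ++ ws′)           ↭⟨ map⁺ swap 𝒟↭ ⟨
  map swap (map (weight (suc k)) (𝒟 (suc k)))  ∎
  where
  open ↭.PermutationReasoning
  ws  = map (weight k) (𝒟 k)
  ws′ = map (weight (suc k)) (unshifted (suc k))
  ws′-symmetric : Symmetric ws′
  ws′-symmetric = unshifted-symmetric (suc k)
  swap-2+² : map 2+² (map swap ws) ≡ map swap (map 2+² ws)
  swap-2+² = trans (sym (map-∘ ws)) (map-∘ ws)
  𝒟↭ : map (weight (suc k)) (𝒟 (suc k)) ↭ map 2+² ws ++ ws′
  𝒟↭ = ↭-trans (map⁺ (weight (suc k)) (𝒟-split k)) (↭-reflexive (trans
    (map-++ (weight (suc k)) (map shift (𝒟 k)) (unshifted (suc k)))
        (cong (_++ ws′) (weight-shift k))))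

mainTheorem3 : (k : ℕ) → .{{_ : NonZero k}} → C k q t ≈ C k t q
mainTheorem3 k = coeff-↭ (begin
  C k q t                                     ≡⟨ C-qt k ⟩
  map (term ∘ weight k) (𝒟 k)                 ≡⟨ map-∘ (𝒟 k) ⟩
  map term (map (weight k) (𝒟 k))             ↭⟨ map⁺ term (weights-symmetric k) ⟩
  map term (map swap (map (weight k) (𝒟 k)))  ≡⟨ cong (map term) (map-∘ (𝒟 k)) ⟨
  map term (map (swap ∘ weight k) (𝒟 k))      ≡⟨ map-∘ (𝒟 k) ⟨
  map (term ∘ swap ∘ weight k) (𝒟 k)          ≡⟨ C-tq k ⟨
  C k t q                                     ∎)
  where open ↭.PermutationReasoning
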